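{- $\mathbf Y^*=\langle\mathcal P,\le,[1]+[1]\rangle$ has the maximal definability property with respect to $\#$: the first-order definable relations of $\mathbf Y^*$ coincide with the first-order definable relations of $\langle\mathcal P,+_\#,\times_\#\rangle$, i.e. $\mathrm{Def}(\mathcal P,\le,[1]+[1])=\mathrm{Def}(\mathcal P,+_\#,\times_\#)$.
   Context: $\mathcal P$ is the set of all integer partitions, including the empty partition $\emptyset$; a partition is a nonincreasing finite sequence of positive integers (its parts). $[n]$ denotes the partition with a single part $n$, and $m[n]$ the partition with exactly $m$ parts equal to $n$. Every nonempty partition has a unique canonical representation $\sigma=\sum_{i=1}^k m_i[n_i]$ with $n_1>\dots>n_k\ge1$, meaning part $n_i$ occurs exactly $m_i\ge1$ times. Let $p_1=2,p_2=3,\dots$ enumerate the primes. Define the bijection $\#:\mathcal P\to\mathbb N$ by $\#\emptyset=0$; $\#(m[1])=p_1^{m-1}$ for $m\ge1$; and $\#\sigma=\prod_{i=1}^k p_{n_i}^{m_i}$ if $\sigma=\sum m_i[n_i]$ has some part $n_i\neq1$. The ternary relations $+_\#,\times_\#$ on $\mathcal P$ are: $(\rho,\sigma,\pi)\in+_\#$ iff $\#\rho+\#\sigma=\#\pi$, and $(\rho,\sigma,\pi)\in\times_\#$ iff $\#\rho\cdot\#\sigma=\#\pi$. Young's lattice $\mathbf Y=\langle\mathcal P,\le\rangle$ has $(s_1,\dots,s_r)\le(n_1,\dots,n_t)$ iff $r\le t$ and $s_i\le n_i$ for all $i\le r$; $\mathbf Y^*$ is $\mathbf Y$ with a constant symbol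 for $[1]+[1]=(1,1)$. For a structure $A$, $\mathrm{Def}(A)$ denotes the set of all relations (of all arities) on its universe definable by first-order formulas without parameters. -}

module Defs where

open import Data.Bool.Base using (if_then_else_)
open import Data.Empty using (⊥)
open import Data.Fin.Base using (Fin)
open import Data.List.Base using (List; []; _∷_; length; map; filter; deduplicate)
open import Data.List.Relation.Binary.Prefix.Heterogeneous using (Prefix)
open import Data.List.Relation.Unary.All as All using (All; []; _∷_; all?)
open import Data.List.Relation.Unary.Linked as Linked using (Linked; [-]; _∷_)
open import Data.Nat.Base using (ℕ; zero; suc; _+_; _*_; _∸_; _^_; _!; _≤_; _<_; _≥_; s<s)
open import Data.Nat.Divisibility using (_∣_; ∣m+n∣m⇒∣n; m≤n⇒m!∣n!; m∣m*n; ∣-trans; ∣1⇒≡1)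
open import Data.Nat.ListAction using (product)
open import Data.Nat.Primality using (Prime; prime?; ¬prime[0]; ¬prime[1])
open import Data.Nat.Primality.Factorisation using (PrimeFactorisation; factorise)
open import Data.Nat.Properties
open import Data.Product.Base using (∃; ∃-syntax; _×_; _,_; proj₁)
open import Data.Sum.Base using (inj₁; inj₂)
open import Data.Vec.Base using (Vec; []; _∷_; lookup)
open import Function.Bundles using (_⇔_)
open import Level using (0ℓ)
open import Relation.Binary.PropositionalEquality using (_≡_; refl; sym; cong₂; subst)
open import Relation.Nullary using (¬_; does; yes; no; contradiction)
open import Relation.Nullary.Decidable using (_×-dec_)
open import Relation.Unary using (Pred; Decidable)

------------------------------------------------------------------------
-- First-order logic with equality

record Language : Set₁ where
  field
    Func : ℕ → Set
    Rel  : ℕ → Set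

open Language public

data Term (L : Language) (n : ℕ) : Set where
  var : Fin n → Term L n
  app : ∀ {k} → Func L k → Vec (Term L n) k → Term L n

infix  6 _≈_
infixr 5 _⇒_

-- The connectives ⊥, ⇒, ∀ are complete for classical logic: ¬ φ is φ ⇒ ⊥,
-- φ ∨ ψ is ¬ φ ⇒ ψ, φ ∧ ψ is ¬ (φ ⇒ ¬ ψ) and ∃ φ is ¬ ∀ ¬ φ.  Taking only
-- these as primitive makes the satisfaction relation below the classical one:
-- it is ¬¬-stable as soon as the atomic formulas are, whereas primitive ∨ and ∃
-- would be read constructively.
data Formula (L : Language) (n : ℕ) : Set where
  _≈_  : Term L n → Term L n → Formula L n
  rel  : ∀ {k} → Rel L k → Vec (Term L n) k → Formula L n
  ⊥′   : Formula L n
  _⇒_  : Formula L n → Formula L n → Formula L n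
  ∀′ : Formula L (suc n) → Formula L n

record Structure (L : Language) (A : Set) : Set₁ where
  field
    funcᴵ : ∀ {k} → Func L k → Vec A k → A
    relᴵ  : ∀ {k} → Rel L k → Pred (Vec A k) 0ℓ

open Structure public

module _ {L : Language} {A : Set} (𝔄 : Structure L A) where

  mutual
    eval : ∀ {n} → Vec A n → Term L n → A
    eval ρ (var i)    = lookup ρ i
    eval ρ (app f ts) = funcᴵ 𝔄 f (evals ρ ts)

    evals : ∀ {n k} → Vec A n → Vec (Term L n) k → Vec A k
    evals ρ []       = []
    evals ρ (t ∷ ts) = eval ρ t ∷ evals ρ ts

  Sat : ∀ {n} → Formula L n → Pred (Vec A n) 0ℓ
  Sat (s ≈ t)    ρ = eval ρ s ≡ eval ρ t
  Sat (rel R ts) ρ = relᴵ 𝔄 R (evals ρ ts)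
  Sat ⊥′         ρ = ⊥
  Sat (φ ⇒ ψ)    ρ = Sat φ ρ → Sat ψ ρ
  Sat (∀′ φ)   ρ = ∀ a → Sat φ (a ∷ ρ)

  Def : (n : ℕ) → Pred (Pred (Vec A n) 0ℓ) 0ℓ
  Def n R = ∃[ φ ] (∀ ρ → R ρ ⇔ Sat {n} φ ρ)

------------------------------------------------------------------------
-- Partitions

record Partition : Set where
  constructor mkPartition
  field
    parts         : List ℕ
    positive      : All (_≥ 1) parts
    nonincreasing : Linked _≥_ parts

open Partition public

parts-injective : ∀ {σ τ} → parts σ ≡ parts τ → σ ≡ τ
parts-injective {mkPartition ns p s} {mkPartition _ p′ s′} refl =
  cong₂ (mkPartition ns) (All.irrelevant ≤-irrelevant p p′)
                         (Linked.irrelevant ≤-irrelevant s s′)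

infix 4 _≤ʸ_

_≤ʸ_ : Partition → Partition → Set
σ ≤ʸ τ = Prefix _≤_ (parts σ) (parts τ)

[1]+[1] : Partition
[1]+[1] = mkPartition (1 ∷ 1 ∷ []) (≤-refl ∷ ≤-refl ∷ []) (≤-refl ∷ [-])

------------------------------------------------------------------------
-- The enumeration of the primes

least : ∀ {P : Pred ℕ 0ℓ} → Decidable P → ∃ P →
        ∃[ m ] P m × (∀ {k} → P k → m ≤ k)
least {P} P? (n , Pn) = search n 0 (subst P (sym (+-identityʳ n)) Pn) λ ()
  where
  search : ∀ d m → P (d + m) → (∀ {k} → k < m → ¬ P k) →
           ∃[ m ] P m × (∀ {k} → P k → m ≤ k)
  search zero    m Pm  ¬P = m , Pm , λ Pk → ≮⇒≥ λ k<m → ¬P k<m Pk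
  search (suc d) m Pdm ¬P with P? m
  ... | yes Pm = m , Pm , λ Pk → ≮⇒≥ λ k<m → ¬P k<m Pk
  ... | no ¬Pm = search d (suc m) (subst P (sym (+-suc d m)) Pdm) ¬P′
    where
    ¬P′ : ∀ {k} → k < suc m → ¬ P k
    ¬P′ k<1+m Pk with m<1+n⇒m<n∨m≡n k<1+m
    ... | inj₁ k<m  = ¬P k<m Pk
    ... | inj₂ refl = ¬Pm Pk

prime-divisor : ∀ n → 1 < n → ∃[ q ] Prime q × q ∣ n
prime-divisor (suc n) 1<n with factorise (suc n)
... | record { factors = [] ; isFactorisation = eq } =
  contradiction 1<n (<-irrefl (sym eq))
... | record { factors = q ∷ qs ; isFactorisation = eq ; factorsPrime = pq ∷ _ } =
  q , pq , subst (q ∣_) (sym eq) (m∣m*n (product qs))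

prime-above : ∀ n → ∃[ q ] n < q × Prime q
prime-above n with prime-divisor (n ! + 1) (subst (1 <_) (+-comm 1 (n !)) (s<s (1≤n! n)))
... | zero  , pq , _ = contradiction pq ¬prime[0]
... | suc q , pq , q∣n!+1 = suc q , ≰⇒> q≰n , pq
  where
  q≰n : ¬ suc q ≤ n
  q≰n q≤n with ∣1⇒≡1 (∣m+n∣m⇒∣n q∣n!+1 (∣-trans (m∣m*n (q !)) (m≤n⇒m!∣n! q≤n)))
  ... | refl = ¬prime[1] pq

next-prime : ∀ n → ∃[ q ] (n < q × Prime q) × (∀ {r} → n < r × Prime r → q ≤ r)
next-prime n = least (λ q → (n <? q) ×-dec prime? q) (prime-above n)

-- p 1 = 2, p 2 = 3, p 3 = 5, …; the value p 0 = 1 only starts the recursion,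
-- since parts are positive.
p : ℕ → ℕ
p zero    = 1
p (suc i) = proj₁ (next-prime (p i))

------------------------------------------------------------------------
-- The bijection with ℕ and the two structures

multiplicity : ℕ → List ℕ → ℕ
multiplicity n ns = length (filter (n ≟_) ns)

-- The canonical representation of ns is Σᵢ mᵢ[nᵢ] with the nᵢ listed by
-- deduplicate and mᵢ the multiplicity of nᵢ.
code : List ℕ → ℕ
code []         = 0
code ns@(_ ∷ _) =
  if does (all? (_≟ 1) ns)
  then p 1 ^ (length ns ∸ 1)
  else product (map (λ n → p n ^ multiplicity n ns) (deduplicate _≟_ ns))

# : Partition → ℕ
# σ = code (parts σ)

data YoungFunc : ℕ → Set where
  𝟏+𝟏 : YoungFunc 0

data YoungRel : ℕ → Set where
  ≤ˢ : YoungRel 2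

data ArithRel : ℕ → Set where
  +ˢ ×ˢ : ArithRel 3

young* : Language
young* = record { Func = YoungFunc ; Rel = YoungRel }

arith : Language
arith = record { Func = λ _ → ⊥ ; Rel = ArithRel }

𝐘* : Structure young* Partition
𝐘* .funcᴵ 𝟏+𝟏 []          = [1]+[1]
𝐘* .relᴵ  ≤ˢ  (σ ∷ τ ∷ []) = σ ≤ʸ τ

𝐍# : Structure arith Partition
𝐍# .funcᴵ ()
𝐍# .relᴵ +ˢ (ρ ∷ σ ∷ π ∷ []) = # ρ + # σ ≡ # π
𝐍# .relᴵ ×ˢ (ρ ∷ σ ∷ π ∷ []) = # ρ * # σ ≡ # π

{-# OPTIONS --safe #-}
module Submission where

open import Data.Bool.Base using (if_then_else_)
open import Data.Empty using (⊥)
open import Data.Fin.Base using (Fin; zero; suc; _↑ʳ_)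
open import Data.Fin.Patterns using (0F; 1F; 2F; 3F; 4F; 5F)
open import Data.List.Base using (List; []; _∷_; _++_; length; map; filter; deduplicate; upTo)
open import Data.List.Membership.Propositional using (_∈_)
open import Data.List.Membership.Propositional.Properties
  using (∈-map⁺; ∈-map⁻; ∈-filter⁺; ∈-filter⁻; ∈-upTo⁺; ∈-upTo⁻; ∈-deduplicate⁺)
open import Data.List.Properties using (filter-++; length-++; filter-accept; filter-reject; ≡-dec)
open import Data.List.Relation.Binary.Permutation.Propositional using (↭-sym)
open import Data.List.Relation.Binary.Permutation.Propositional.Properties
  using (All-resp-↭; filter-↭; map⁺; ↭-length)
open import Data.List.Relation.Binary.Prefix.Heterogeneous using (Prefix; []; _∷_)
open import Data.List.Relation.Binary.Prefix.Heterogeneous.Properties using (prefix?)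
open import Data.List.Relation.Unary.All as All using (All; []; _∷_; all?)
import Data.List.Relation.Unary.All.Properties as All
open import Data.List.Relation.Unary.AllPairs using (_∷_)
open import Data.List.Relation.Unary.Any using (here; there)
open import Data.List.Relation.Unary.Linked using (Linked; []; [-]; _∷_)
open import Data.List.Relation.Unary.Unique.Propositional using (Unique)
open import Data.Nat.Base
open import Data.Nat.Divisibility
open import Data.Nat.ListAction using (product)
open import Data.Nat.ListAction.Properties using (∈⇒∣product; product-++; product-↭)
open import Data.Nat.Primality
open import Data.Nat.Primality.Factorisation
open import Data.Nat.Properties
open import Data.Product.Base using (∃-syntax; _×_; _,_; proj₁; proj₂)
open import Data.Sum.Base using (_⊎_; inj₁; inj₂)
open import Data.Vec.Base as Vec using (Vec; []; _∷_; head; tail; lookup)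
open import Data.Vec.Properties using (lookup-map)
open import Function.Base using (id; _∘_)
open import Function.Bundles using (_⇔_; mk⇔; Equivalence)
open import Function.Properties.Equivalence using (⇔-isEquivalence)
open import Level using (0ℓ)
open import Relation.Binary.Construct.Closure.ReflexiveTransitive
  using (Star; ε; _◅_; _◅◅_; gmap)
import Relation.Binary.Construct.Flip.Ord as Flip
open import Relation.Binary.Definitions using (tri<; tri≈; tri>)
open import Relation.Binary.PropositionalEquality
open import Relation.Binary.Structures using (IsEquivalence)
open import Relation.Nullary using (¬_; Dec; yes; no; contradiction)
open import Relation.Nullary.Decidable using (decidable-stable; dec-true; dec-false)
open import Relation.Nullary.Negation.Core using (Stable)
open import Relation.Unary using (Pred; Decidable; _≐_)
open import Data.List.Relation.Unary.Unique.DecPropositional.Properties _≟_ using (deduplicate-!)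
open import Data.List.Sort (Flip.decTotalOrder ≤-decTotalOrder) using (sort; sort-↭; sort-↗)
open import Defs

-- Put ∏p σ for the product of the primes p n over the parts n of σ; # σ is ∏p σ
-- except that it is half of it on a nonempty column and 0 on ∅.
--
-- Young order in arithmetic: σ ≤ τ iff ∏p τ arises from ∏p σ by repeatedly
-- multiplying by 2 or replacing a prime factor by the next prime.  Reachability
-- is quantification over closed finite sets, and a finite set is coded as the
-- set of u with 1 + (1 + u) d ∣ c.
--
-- Arithmetic in Young's lattice: the constant singles out the rows, so the largest
-- part and the number of parts can be compared, and a ≤ σᵢ says that every
-- partition with parts at most a and at most i + 1 rows lies below σ.  A partition
-- is then a nonincreasing sequence with definable entries, i.e. the history of a
-- recursion along an increasing function.  This yields +, ×, the enumeration of
-- the primes, ∏p and finally #.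

-- Definable relations

open Equivalence using (to; from)
module ⇔ = IsEquivalence (⇔-isEquivalence {0ℓ})

infixr 0 _→-⇔_

_→-⇔_ : {P P′ Q Q′ : Set} → P ⇔ P′ → Q ⇔ Q′ → (P → Q) ⇔ (P′ → Q′)
e →-⇔ f = mk⇔ (λ h → to f ∘ h ∘ from e) (λ h → from f ∘ h ∘ to e)

∀-⇔ : {A : Set} {P Q : A → Set} → (∀ a → P a ⇔ Q a) → (∀ a → P a) ⇔ (∀ a → Q a)
∀-⇔ e = mk⇔ (λ h a → to (e a) (h a)) (λ h a → from (e a) (h a))

-- Conjunction is encoded through `⇒` and `⊥′`, so getting a conjunct back needs double-negation
-- stability. Stability of the atoms suffices, because the connectives `⊥′`, `⇒` and `∀′` preserve
-- it.
record AtomsStable {L : Language} {A : Set} (𝔄 : Structure L A) : Set where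
  field
    ≡-stable   : (a b : A) → Stable (a ≡ b)
    rel-stable : ∀ {k} (R : Rel L k) v → Stable (relᴵ 𝔄 R v)

open AtomsStable

Sat-stable : ∀ {L A} {𝔄 : Structure L A} → AtomsStable 𝔄 →
             ∀ {n} (φ : Formula L n) ρ → Stable (Sat 𝔄 φ ρ)
Sat-stable st (s ≈ t)    ρ = ≡-stable st _ _
Sat-stable st (rel R ts) ρ = rel-stable st R _
Sat-stable st ⊥′         ρ ¬¬⊥ = ¬¬⊥ id
Sat-stable st (φ ⇒ ψ)    ρ ¬¬h p = Sat-stable st ψ ρ λ ¬q → ¬¬h λ h → ¬q (h p)
Sat-stable st (∀′ φ)     ρ ¬¬h a = Sat-stable st φ (a ∷ ρ) λ ¬q → ¬¬h λ h → ¬q (h a)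

-- Ranging over all variable positions in contexts of any length builds in weakening and renaming:
-- under quantifiers an instance is simply taken at shifted indices.
Def¹ : ∀ {L A} → Structure L A → Pred A 0ℓ → Set
Def¹ 𝔄 P = ∀ {n} (x : Fin n) → Def 𝔄 n λ ρ → P (lookup ρ x)

Def² : ∀ {L A} → Structure L A → (A → A → Set) → Set
Def² 𝔄 R = ∀ {n} (x y : Fin n) → Def 𝔄 n λ ρ → R (lookup ρ x) (lookup ρ y)

Def³ : ∀ {L A} → Structure L A → (A → A → A → Set) → Set
Def³ 𝔄 R = ∀ {n} (x y z : Fin n) →
           Def 𝔄 n λ ρ → R (lookup ρ x) (lookup ρ y) (lookup ρ z)

module _ {L : Language} {A : Set} {𝔄 : Structure L A} where

  Def-resp : ∀ {n} {P Q : Pred (Vec A n) 0ℓ} →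
             (∀ ρ → P ρ ⇔ Q ρ) → Def 𝔄 n P → Def 𝔄 n Q
  Def-resp e (φ , h) = φ , λ ρ → ⇔.trans (⇔.sym (e ρ)) (h ρ)

  ⊥-def : ∀ {n} → Def 𝔄 n λ _ → ⊥
  ⊥-def = ⊥′ , λ _ → ⇔.refl

  infixr 5 _⇒-def_

  _⇒-def_ : ∀ {n} {P Q : Pred (Vec A n) 0ℓ} → Def 𝔄 n P → Def 𝔄 n Q →
            Def 𝔄 n λ ρ → P ρ → Q ρ
  (φ , h) ⇒-def (ψ , k) = (φ ⇒ ψ) , λ ρ → h ρ →-⇔ k ρ

  ∀-def : ∀ {n} {P : Pred (Vec A (suc n)) 0ℓ} → Def 𝔄 (suc n) P →
          Def 𝔄 n λ ρ → ∀ a → P (a ∷ ρ)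
  ∀-def (φ , h) = ∀′ φ , λ ρ → ∀-⇔ λ a → h (a ∷ ρ)

  ¬-def : ∀ {n} {P : Pred (Vec A n) 0ℓ} → Def 𝔄 n P → Def 𝔄 n λ ρ → ¬ P ρ
  ¬-def P-def = P-def ⇒-def ⊥-def

  ≡-def : Def² 𝔄 _≡_
  ≡-def x y = var x ≈ var y , λ _ → ⇔.refl

  module Conjunction (st : AtomsStable 𝔄) where

    infixr 6 _×-def_

    _×-def_ : ∀ {n} {P Q : Pred (Vec A n) 0ℓ} → Def 𝔄 n P → Def 𝔄 n Q →
              Def 𝔄 n λ ρ → P ρ × Q ρ
    (φ , h) ×-def (ψ , k) = ((φ ⇒ ψ ⇒ ⊥′) ⇒ ⊥′) , λ ρ → mk⇔
      (λ (p , q) f → f (to (h ρ) p) (to (k ρ) q))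
      (λ f → from (h ρ) (Sat-stable st φ ρ λ ¬p → f λ p _ → ¬p p)
           , from (k ρ) (Sat-stable st ψ ρ λ ¬q → f λ _ q → ¬q q))

-- Both structures share the universe `A`, so connectives and quantifiers carry over unchanged and
-- only atomic formulas need a translation.
Sat-def : ∀ {L L′ A} {𝔄 : Structure L A} {𝔅 : Structure L′ A} →
          (∀ {n} (s t : Term L n) → Def 𝔅 n (Sat 𝔄 (s ≈ t))) →
          (∀ {n k} (R : Rel L k) (ts : Vec (Term L n) k) → Def 𝔅 n (Sat 𝔄 (rel R ts))) →
          ∀ {n} (φ : Formula L n) → Def 𝔅 n (Sat 𝔄 φ)
Sat-def ≈-def rel-def (s ≈ t)    = ≈-def s t
Sat-def ≈-def rel-def (rel R ts) = rel-def R ts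
Sat-def ≈-def rel-def ⊥′         = ⊥-def
Sat-def ≈-def rel-def (φ ⇒ ψ)    = Sat-def ≈-def rel-def φ ⇒-def Sat-def ≈-def rel-def ψ
Sat-def ≈-def rel-def (∀′ φ)     = ∀-def (Sat-def ≈-def rel-def φ)

-- Interpreting the arithmetic of natural numbers in another structure.

𝐍 : Structure arith ℕ
𝐍 .funcᴵ ()
𝐍 .relᴵ +ˢ (k ∷ m ∷ n ∷ []) = k + m ≡ n
𝐍 .relᴵ ×ˢ (k ∷ m ∷ n ∷ []) = k * m ≡ n

𝐍-stable : AtomsStable 𝐍
𝐍-stable .≡-stable m n = decidable-stable (m ≟ n)
𝐍-stable .rel-stable +ˢ (k ∷ m ∷ n ∷ []) = decidable-stable (k + m ≟ n)
𝐍-stable .rel-stable ×ˢ (k ∷ m ∷ n ∷ []) = decidable-stable (k * m ≟ n)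

-- Several elements may stand for one number, so equality of numbers is interpreted by
-- `num a ≡ num b`. Surjectivity, given by `rep`, makes the universal quantifiers agree.
module Interpretation
  {L : Language} {A : Set} {𝔄 : Structure L A}
  (num : A → ℕ) (rep : ℕ → A) (num-rep : ∀ n → num (rep n) ≡ n)
  (num-≡-def : Def² 𝔄 λ a b → num a ≡ num b)
  (num-+-def : Def³ 𝔄 λ a b c → num a + num b ≡ num c)
  (num-*-def : Def³ 𝔄 λ a b c → num a * num b ≡ num c)
  where

  lift : ∀ {n} (φ : Formula arith n) → Def 𝔄 n λ ρ → Sat 𝐍 φ (Vec.map num ρ)
  lift (var x ≈ var y) = Def-resp
    (λ ρ → ⇔.reflexive (sym (cong₂ _≡_ (lookup-map x num ρ) (lookup-map y num ρ))))
    (num-≡-def x y)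
  lift (rel +ˢ (var x ∷ var y ∷ var z ∷ [])) = Def-resp
    (λ ρ → ⇔.reflexive (sym (cong₂ _≡_
      (cong₂ _+_ (lookup-map x num ρ) (lookup-map y num ρ)) (lookup-map z num ρ))))
    (num-+-def x y z)
  lift (rel ×ˢ (var x ∷ var y ∷ var z ∷ [])) = Def-resp
    (λ ρ → ⇔.reflexive (sym (cong₂ _≡_
      (cong₂ _*_ (lookup-map x num ρ) (lookup-map y num ρ)) (lookup-map z num ρ))))
    (num-*-def x y z)
  lift ⊥′      = ⊥-def
  lift (φ ⇒ ψ) = lift φ ⇒-def lift ψ
  lift (∀′ φ)  = Def-resp
    (λ ρ → mk⇔ (λ h n → subst (λ m → Sat 𝐍 φ (m ∷ Vec.map num ρ)) (num-rep n) (h (rep n)))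
               (λ h a → h (num a)))
    (∀-def (lift φ))

  lift-def : ∀ {n} {P : Pred (Vec ℕ n) 0ℓ} → Def 𝐍 n P → Def 𝔄 n λ ρ → P (Vec.map num ρ)
  lift-def (φ , h) = Def-resp (λ ρ → ⇔.sym (h (Vec.map num ρ))) (lift φ)

  lift¹ : (P : ℕ → Set) → Def¹ 𝐍 P → Def¹ 𝔄 λ a → P (num a)
  lift¹ P P-def x = Def-resp (λ ρ → ⇔.reflexive (cong P (lookup-map x num ρ)))
    (lift-def (P-def x))

  lift² : (R : ℕ → ℕ → Set) → Def² 𝐍 R → Def² 𝔄 λ a b → R (num a) (num b)
  lift² R R-def x y = Def-resp
    (λ ρ → ⇔.reflexive (cong₂ R (lookup-map x num ρ) (lookup-map y num ρ)))
    (lift-def (R-def x y))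

-- Basic arithmetic relations and the next prime, defined over `𝐍`.

next : ℕ → ℕ
next n = proj₁ (next-prime n)

n<next[n] : ∀ n → n < next n
n<next[n] n = proj₁ (proj₁ (proj₂ (next-prime n)))

next-isPrime : ∀ n → Prime (next n)
next-isPrime n = proj₂ (proj₁ (proj₂ (next-prime n)))

next-least : ∀ {n r} → n < r → Prime r → next n ≤ r
next-least {n} n<r pr = proj₂ (proj₂ (next-prime n)) (n<r , pr)

IsNext : ℕ → ℕ → Set
IsNext n q = (n < q × Prime q) × (∀ r → n < r → Prime r → q ≤ r)

isNext⇔ : ∀ {n q} → IsNext n q ⇔ next n ≡ q
isNext⇔ {n} = mk⇔
  (λ ((n<q , pq) , least) → ≤-antisym (next-least n<q pq) (least _ (n<next[n] n) (next-isPrime n)))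
  (λ { refl → (n<next[n] n , next-isPrime n) , λ _ → next-least })

-- The implication from `d ≢ 1` replaces the disjunction in irreducibility, since disjunction is not
-- a primitive connective.
irreducible⇔prime : ∀ {n} → (n ≢ 1 × (∀ d → d ∣ n → d ≢ 1 → d ≡ n)) ⇔ Prime n
irreducible⇔prime {zero} = mk⇔
  (λ (_ , irr) → contradiction (irr 2 (divides 0 refl) λ ()) λ ())
  (λ p₀ → contradiction p₀ ¬prime[0])
irreducible⇔prime {1} = mk⇔
  (λ (1≢1 , _) → contradiction refl 1≢1)
  (λ p₁ → contradiction p₁ ¬prime[1])
irreducible⇔prime {suc (suc n)} = mk⇔
  (λ (_ , irr) → irreducible⇒prime λ {d} d∣n → dec (irr d d∣n))
  (λ pn → (λ ()) , λ d d∣n d≢1 → fromSum d≢1 (prime⇒irreducible pn d∣n))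
  where
  dec : ∀ {d m} → (d ≢ 1 → d ≡ m) → d ≡ 1 ⊎ d ≡ m
  dec {d} h with d ≟ 1
  ... | yes d≡1 = inj₁ d≡1
  ... | no d≢1 = inj₂ (h d≢1)
  fromSum : ∀ {d m} → d ≢ 1 → d ≡ 1 ⊎ d ≡ m → d ≡ m
  fromSum d≢1 (inj₁ d≡1) = contradiction d≡1 d≢1
  fromSum _   (inj₂ d≡m) = d≡m

module Arithmetic where

  open Conjunction 𝐍-stable

  +-def : Def³ 𝐍 λ k m n → k + m ≡ n
  +-def x y z = rel +ˢ (var x ∷ var y ∷ var z ∷ []) , λ _ → ⇔.refl

  *-def : Def³ 𝐍 λ k m n → k * m ≡ n
  *-def x y z = rel ×ˢ (var x ∷ var y ∷ var z ∷ []) , λ _ → ⇔.refl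

  0-def : Def¹ 𝐍 (_≡ 0)
  0-def x = Def-resp
    (λ ρ → mk⇔ (+-cancelˡ-≡ _ _ 0 ∘ λ h → trans h (sym (+-identityʳ _))) λ eq → cong₂ _+_ eq refl)
    (+-def x x x)

  1-def : Def¹ 𝐍 (_≡ 1)
  1-def x = Def-resp
    (λ ρ → mk⇔ (λ h → trans (sym (*-identityʳ _)) (h 1))
               λ eq n → trans (cong (_* n) eq) (*-identityˡ n))
    (∀-def (*-def (suc x) 0F 0F))

  -- The language has no function symbols. An intermediate value is named by a universally
  -- quantified variable with its graph as hypothesis; as the value exists and is unique, this
  -- replaces an existential. The device recurs throughout.
  suc-def : Def² 𝐍 λ m n → suc m ≡ n
  suc-def x y = Def-resp (λ ρ → mk⇔ (λ h → h 1 refl) λ { eq _ refl → eq })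
    (∀-def (1-def 0F ⇒-def +-def 0F (suc x) (suc y)))

  2-def : Def¹ 𝐍 (_≡ 2)
  2-def x = Def-resp (λ ρ → mk⇔ (λ h → sym (h 1 refl)) λ { eq _ refl → sym eq })
    (∀-def (1-def 0F ⇒-def suc-def 0F (suc x)))

  double-def : Def² 𝐍 λ m n → 2 * m ≡ n
  double-def x y = Def-resp (λ ρ → mk⇔ (λ h → h 2 refl) λ { eq _ refl → eq })
    (∀-def (2-def 0F ⇒-def *-def 0F (suc x) (suc y)))

  ≤-def : Def² 𝐍 _≤_
  ≤-def x y = Def-resp
    (λ ρ → mk⇔
      -- The existential is written as a negated universal; decidability of `≤` removes the double
      -- negation.
      (λ h → decidable-stable (_ ≤? _) λ ≰ → h λ k eq → ≰ (subst (_ ≤_) eq (m≤m+n _ k)))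
      (λ m≤n h → h _ (m+[n∸m]≡n m≤n)))
    (¬-def (∀-def (¬-def (+-def (suc x) 0F (suc y)))))

  <-def : Def² 𝐍 _<_
  <-def x y = Def-resp (λ ρ → mk⇔ ≰⇒> <⇒≱) (¬-def (≤-def y x))

  ∣-def : Def² 𝐍 _∣_
  ∣-def x y = Def-resp
    (λ ρ → mk⇔
      (λ h → decidable-stable (_ ∣? _) λ ∤ → h λ k eq → ∤ (divides k (sym eq)))
      (λ (divides k eq) h → h k (sym eq)))
    (¬-def (∀-def (¬-def (*-def 0F (suc x) (suc y)))))

  prime-def : Def¹ 𝐍 Prime
  prime-def x = Def-resp (λ _ → irreducible⇔prime)
    (¬-def (1-def x) ×-def
     ∀-def (∣-def 0F (suc x) ⇒-def ¬-def (1-def 0F) ⇒-def ≡-def 0F (suc x)))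

  next-def : Def² 𝐍 λ m n → next m ≡ n
  next-def x y = Def-resp (λ _ → isNext⇔)
    ((<-def x y ×-def prime-def y) ×-def
     ∀-def (<-def (suc x) 0F ⇒-def prime-def 0F ⇒-def ≤-def (suc y) 0F))

-- Primes and coded finite sets

open PrimeFactorisation using (isFactorisation; factorsPrime)

-- The moduli of Gödel's beta function. Using `suc u` instead of `u` keeps the modulus of 0
-- different from 1 for positive `d`.
modulus : ℕ → ℕ → ℕ
modulus d u = suc (suc u * d)

prime∣product : ∀ {q} → Prime q → ∀ ms → q ∣ product ms → ∃[ m ] m ∈ ms × q ∣ m
prime∣product pq []       q∣1 = contradiction (subst Prime (∣1⇒≡1 q∣1) pq) ¬prime[1]
prime∣product pq (m ∷ ms) q∣ with euclidsLemma m (product ms) pq q∣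
... | inj₁ q∣m  = m , here refl , q∣m
... | inj₂ q∣ms with n , n∈ms , q∣n ← prime∣product pq ms q∣ms = n , there n∈ms , q∣n

suc∣! : ∀ {k N} → suc k ≤ N → suc k ∣ N !
suc∣! k<N = ∣-trans (m∣m*n _) (m≤n⇒m!∣n! k<N)

-- A common prime divides the difference `suc k * N !`, hence `N !` because `suc k ≤ N`, and
-- therefore also 1.
¬common-prime : ∀ {q N} u k → Prime q → suc (u + k) ≤ N →
                q ∣ modulus (N !) u → ¬ q ∣ modulus (N !) (suc (u + k))
¬common-prime {q} {N} u k pq u+k<N q∣u q∣i =
  contradiction (subst Prime (∣1⇒≡1 q∣1) pq) ¬prime[1]
  where
  split : modulus (N !) (suc (u + k)) ≡ modulus (N !) u + suc k * N !
  split = cong suc (trans (cong (λ m → suc m * N !) (sym (+-suc u k)))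
                          (*-distribʳ-+ (N !) (suc u) (suc k)))
  q∣N! : q ∣ N !
  q∣N! with euclidsLemma (suc k) (N !) pq (∣m+n∣m⇒∣n (subst (q ∣_) split q∣i) q∣u)
  ... | inj₁ q∣k  = ∣-trans q∣k (suc∣! (≤-trans (s≤s (m≤n+m k u)) u+k<N))
  ... | inj₂ q∣N! = q∣N!
  q∣1 : q ∣ 1
  q∣1 = ∣m+n∣m⇒∣n (subst (q ∣_) (+-comm 1 _) q∣u) (∣n⇒∣m*n (suc u) q∣N!)

moduli-coprime : ∀ {q N u i} → Prime q → u ≤ N → i ≤ N →
                 q ∣ modulus (N !) u → q ∣ modulus (N !) i → u ≡ i
moduli-coprime {u = u} {i} pq u≤N i≤N q∣u q∣i with <-cmp u i
... | tri≈ _ u≡i _ = u≡i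
... | tri< u<i _ _ with k , refl ← m≤n⇒∃[o]m+o≡n u<i =
  contradiction q∣i (¬common-prime u k pq i≤N q∣u)
... | tri> _ _ i<u with k , refl ← m≤n⇒∃[o]m+o≡n i<u =
  contradiction q∣u (¬common-prime i k pq u≤N q∣i)

-- Take `c` to be the product of the moduli of the members up to `N`, with `d` equal to `N !`. If a
-- modulus divides `c`, one of its primes divides the modulus of a member, and coprimality
-- identifies the two indices.
encode-set : ∀ {P : Pred ℕ 0ℓ} → Decidable P → ∀ N →
             ∃[ c ] ∃[ d ] (∀ u → u ≤ N → P u ⇔ modulus d u ∣ c)
encode-set {P} P? N = product (map (modulus (N !)) us) , N ! , λ u u≤N → mk⇔
  (λ Pu → ∈⇒∣product (∈-map⁺ (modulus (N !)) (∈-filter⁺ P? (∈-upTo⁺ (s≤s u≤N)) Pu)))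
  (decode u u≤N)
  where
  us = filter P? (upTo (suc N))
  decode : ∀ u → u ≤ N → modulus (N !) u ∣ product (map (modulus (N !)) us) → P u
  decode u u≤N m∣
    with q , pq , q∣m ← prime-divisor (modulus (N !) u) (s<s (*-mono-≤ (s≤s (z≤n {u})) (1≤n! N)))
    with m , m∈ , q∣m′ ← prime∣product pq (map (modulus (N !)) us) (∣-trans q∣m m∣)
    with i , i∈ , refl ← ∈-map⁻ (modulus (N !)) {xs = us} m∈
    with i∈′ , Pi ← ∈-filter⁻ P? {xs = upTo (suc N)} i∈ =
    subst P (sym (moduli-coprime pq u≤N (s≤s⁻¹ (∈-upTo⁻ i∈′)) q∣m q∣m′)) Pi

-- Properties of the enumeration of the primes.

p≥1 : ∀ n → 1 ≤ p n
p≥1 zero    = ≤-refl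
p≥1 (suc n) = ≤-trans (p≥1 n) (<⇒≤ (n<next[n] (p n)))

p-prime : ∀ {n} → 1 ≤ n → Prime (p n)
p-prime {suc n} _ = next-isPrime (p n)

n<p[n] : ∀ n → n < p n
n<p[n] zero    = ≤-refl
n<p[n] (suc n) = ≤-<-trans (n<p[n] n) (n<next[n] (p n))

p-mono : ∀ {m n} → m ≤ n → p m ≤ p n
p-mono {n = zero}  z≤n = ≤-refl
p-mono {n = suc n} m≤1+n with m≤n⇒m<n∨m≡n m≤1+n
... | inj₁ m<1+n = ≤-trans (p-mono (s≤s⁻¹ m<1+n)) (<⇒≤ (n<next[n] (p n)))
... | inj₂ refl  = ≤-refl

p-mono-< : ∀ {m n} → m < n → p m < p n
p-mono-< {m} m<n = <-≤-trans (n<next[n] (p m)) (p-mono m<n)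

p[1]≡2 : p 1 ≡ 2
p[1]≡2 = ≤-antisym (next-least ≤-refl prime[2]) (n<p[n] 1)

-- By minimality of `next` the enumeration cannot jump over `q`, and since `q < p q` it must have
-- met `q` by index `q`.
p-surjective : ∀ {q} → Prime q → ∃[ i ] 1 ≤ i × p i ≡ q
p-surjective {q} pq with search q
  where
  search : ∀ n → (∃[ i ] 1 ≤ i × p i ≡ q) ⊎ p n < q
  search zero    = inj₂ (nonTrivial⇒n>1 q {{prime⇒nonTrivial pq}})
  search (suc n) with search n
  ... | inj₁ found = inj₁ found
  ... | inj₂ pn<q with m≤n⇒m<n∨m≡n (next-least pn<q pq)
  ...   | inj₁ below = inj₂ below
  ...   | inj₂ eq    = inj₁ (suc n , s≤s z≤n , eq)
... | inj₁ found = found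
... | inj₂ pq<q = contradiction (n<p[n] q) (<-asym pq<q)

-- Counting prime factors above a threshold.

count≥ : ℕ → List ℕ → ℕ
count≥ t ns = length (filter (t ≤?_) ns)

-- Prime factors at least `t`, counted with multiplicity; 0 has no factorisation and gets the
-- default 0. On products of primes `p n` these numbers are the column lengths of the Young diagram.
weight : ℕ → ℕ → ℕ
weight t zero      = 0
weight t n@(suc _) = count≥ t (factors (factorise n))

-- Unique factorisation up to permutation lets any list of primes stand in for the one chosen by
-- `factorise`.
weight-product : ∀ t {qs} → All Prime qs → weight t (product qs) ≡ count≥ t qs
weight-product t {qs} pqs with product qs in eq | productOfPrimes≥1 pqs
... | suc n | _ =
  ↭-length (filter-↭ (t ≤?_) (factorisationUnique (factorise (suc n)) qs-factorisation))
  where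
  qs-factorisation : PrimeFactorisation (suc n)
  qs-factorisation = record { factors = qs ; isFactorisation = sym eq ; factorsPrime = pqs }

weight-* : ∀ t m n → 1 ≤ m → 1 ≤ n → weight t (m * n) ≡ weight t m + weight t n
weight-* t m@(suc _) n@(suc _) _ _ = begin
  weight t (m * n)                   ≡⟨ cong (weight t) mn≡ ⟩
  weight t (product (ms ++ ns))
    ≡⟨ weight-product t (All.++⁺ (factorsPrime fm) (factorsPrime fn)) ⟩
  count≥ t (ms ++ ns)                ≡⟨ cong length (filter-++ (t ≤?_) ms ns) ⟩
  length (filter (t ≤?_) ms ++ filter (t ≤?_) ns) ≡⟨ length-++ (filter (t ≤?_) ms) ⟩
  weight t m + weight t n            ∎
  where
  open ≡-Reasoning
  fm = factorise m
  fn = factorise n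
  ms = factors fm
  ns = factors fn
  mn≡ : m * n ≡ product (ms ++ ns)
  mn≡ = trans (cong₂ _*_ (isFactorisation fm) (isFactorisation fn)) (sym (product-++ ms ns))

count≥-accept : ∀ {t n} ns → t ≤ n → count≥ t (n ∷ ns) ≡ suc (count≥ t ns)
count≥-accept {t} _ t≤n = cong length (filter-accept (t ≤?_) t≤n)

count≥-reject : ∀ {t n} ns → t ≰ n → count≥ t (n ∷ ns) ≡ count≥ t ns
count≥-reject {t} _ t≰n = cong length (filter-reject (t ≤?_) t≰n)

count≥-[-] : ∀ t {m n} → m ≤ n → count≥ t (m ∷ []) ≤ count≥ t (n ∷ [])
count≥-[-] t {m} {n} m≤n = go (t ≤? m)
  where
  go : Dec (t ≤ m) → count≥ t (m ∷ []) ≤ count≥ t (n ∷ [])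
  go (no t≰m)  = subst (_≤ _) (sym (count≥-reject [] t≰m)) z≤n
  go (yes t≤m) = ≤-reflexive (trans (count≥-accept [] t≤m)
    (sym (count≥-accept [] (≤-trans t≤m m≤n))))

weight-prime : ∀ t {q} → Prime q → weight t q ≡ count≥ t (q ∷ [])
weight-prime t {q} pq = trans (cong (weight t) (sym (*-identityʳ q))) (weight-product t (pq ∷ []))

-- On products of the p n, multiplying by next 1 = p 1 adds a part 1 and
-- replacing a prime factor by the next prime adds a box to some part.
data Step : ℕ → ℕ → Set where
  step : ∀ q w → (q ≢ 1 → Prime q) → Step (q * w) (next q * w)

weight-next : ∀ t {q} → (q ≢ 1 → Prime q) → weight t q ≤ weight t (next q)
weight-next t {q} q-ok with q ≟ 1
... | yes refl = z≤n
... | no q≢1 = subst₂ _≤_ (sym (weight-prime t (q-ok q≢1))) (sym (weight-prime t (next-isPrime q)))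
  (count≥-[-] t (<⇒≤ (n<next[n] q)))

-- A step adds a prime factor or enlarges one, so the count above a fixed threshold cannot drop.
-- This is the invariant that bounds reachability.
weight-step : ∀ t {u v} → Step u v → weight t u ≤ weight t v
-- If a factor is 0, the source of the step is 0 and has weight 0.
weight-step t (step q zero q-ok)
  rewrite *-zeroʳ q = z≤n
weight-step t (step zero w q-ok) = z≤n
weight-step t (step q@(suc _) w@(suc _) q-ok) = begin
  weight t (q * w)               ≡⟨ weight-* t q w (s≤s z≤n) (s≤s z≤n) ⟩
  weight t q + weight t w        ≤⟨ +-monoˡ-≤ (weight t w) (weight-next t q-ok) ⟩
  weight t (next q) + weight t w
    ≡⟨ weight-* t (next q) w (≤-trans (s≤s z≤n) (n<next[n] q)) (s≤s z≤n) ⟨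
  weight t (next q * w)          ∎
  where open ≤-Reasoning

step-≤ : ∀ {u v} → Step u v → u ≤ v
step-≤ (step q w _) = *-monoˡ-≤ w (<⇒≤ (n<next[n] q))

steps-≤ : ∀ {u v} → Star Step u v → u ≤ v
steps-≤ ε        = ≤-refl
steps-≤ (s ◅ ss) = ≤-trans (step-≤ s) (steps-≤ ss)

steps-* : ∀ k {u v} → Star Step u v → Star Step (k * u) (k * v)
steps-* k = gmap (k *_) λ { (step q w q-ok) →
  subst₂ Step (swap q w) (swap (next q) w) (step q (k * w) q-ok) }
  where
  swap : ∀ m w → m * (k * w) ≡ k * (m * w)
  swap m w = trans (sym (*-assoc m k w)) (trans (cong (_* w) (*-comm m k)) (*-assoc k m w))

-- Closure is demanded only up to `b`: a code controls membership only up to a bound, and since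
-- steps never decrease, a path ending in `b` stays within it.
Reach : ℕ → ℕ → Set
Reach a b = ∀ c d → modulus d a ∣ c →
  (∀ q w u v → (q ≢ 1 → Prime q) → q * w ≡ u → next q * w ≡ v → v ≤ b →
   modulus d u ∣ c → modulus d v ∣ c) →
  modulus d b ∣ c

steps⇒reach : ∀ {a b} → Star Step a b → Reach a b
steps⇒reach {b = b} steps c d a∈ closed = go steps a∈
  where
  go : ∀ {u} → Star Step u b → modulus d u ∣ c → modulus d b ∣ c
  go ε u∈ = u∈
  go (step q w q-ok ◅ ss) u∈ =
    go ss (closed q w (q * w) (next q * w) q-ok refl refl (steps-≤ ss) u∈)

-- Apply reachability to a code of the set of `u` with `weight t a ≤ weight t u`; it contains `a`
-- and is closed under steps.
reach⇒weight-≤ : ∀ {a b} → Reach a b → ∀ t → weight t a ≤ weight t b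
reach⇒weight-≤ {a} {b} reach t
  -- The bound covers `a` too, because `a ≤ b` is not known at this point.
  with c , d , iff ← encode-set (λ u → weight t a ≤? weight t u) (a ⊔ b) =
  from (iff b (m≤n⊔m a b)) (reach c d (to (iff a (m≤m⊔n a b)) ≤-refl)
    λ { q w _ _ q-ok refl refl v≤b u∈ →
      let v≤ = ≤-trans v≤b (m≤n⊔m a b)
          s = step q w q-ok
      in to (iff _ v≤) (≤-trans (from (iff _ (≤-trans (step-≤ s) v≤)) u∈) (weight-step t s)) })

open Arithmetic

modulus∣-def : Def³ 𝐍 λ d u c → modulus d u ∣ c
modulus∣-def d u c = Def-resp
  (λ ρ → mk⇔ (λ h → h _ refl _ refl _ refl) λ { m∣c _ refl _ refl _ refl → m∣c })
  (∀-def (suc-def (suc u) 0F ⇒-def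
   ∀-def (*-def 1F (2 ↑ʳ d) 0F ⇒-def
   ∀-def (suc-def 1F 0F ⇒-def ∣-def 0F (3 ↑ʳ c)))))

next-*-def : Def³ 𝐍 λ q w v → next q * w ≡ v
next-*-def q w v = Def-resp
  (λ ρ → mk⇔ (λ h → h _ refl) λ { eq _ refl → eq })
  (∀-def (next-def (suc q) 0F ⇒-def *-def 0F (suc w) (suc v)))

reach-def : Def² 𝐍 Reach
reach-def a b =
  ∀-def (∀-def (modulus∣-def 0F (2 ↑ʳ a) 1F ⇒-def
  (∀-def (∀-def (∀-def (∀-def
    ((¬-def (1-def 3F) ⇒-def prime-def 3F) ⇒-def *-def 3F 2F 1F ⇒-def
     next-*-def 3F 2F 0F ⇒-def ≤-def 0F (6 ↑ʳ b) ⇒-def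
     modulus∣-def 4F 1F 5F ⇒-def modulus∣-def 4F 0F 5F))))) ⇒-def
  modulus∣-def 0F (2 ↑ʳ b) 1F))

-- Partitions and their codes

-- The default 0 beyond the end turns a partition into an infinite nonincreasing sequence, on which
-- Young's order is the pointwise order.
nth : List ℕ → ℕ → ℕ
nth []       _       = 0
nth (n ∷ _)  zero    = n
nth (_ ∷ ns) (suc i) = nth ns i

part : Partition → ℕ → ℕ
part σ = nth (parts σ)

len : Partition → ℕ
len σ = length (parts σ)

nth-antitone : ∀ {ns} → Linked _≥_ ns → ∀ i → nth ns (suc i) ≤ nth ns i
nth-antitone []       i       = z≤n
nth-antitone [-]      i       = z≤n
nth-antitone (r ∷ l)  zero    = r
nth-antitone (r ∷ l)  (suc i) = nth-antitone l i

nth-≤-head : ∀ {ns} → Linked _≥_ ns → ∀ i → nth ns i ≤ nth ns 0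
nth-≤-head l zero    = ≤-refl
nth-≤-head l (suc i) = ≤-trans (nth-antitone l i) (nth-≤-head l i)

nth-positive : ∀ {ns} → All (_≥ 1) ns → ∀ {i} → i < length ns → 1 ≤ nth ns i
nth-positive (n≥1 ∷ _)  {zero}  _   = n≥1
nth-positive (_ ∷ ns≥1) {suc i} i<l = nth-positive ns≥1 (s≤s⁻¹ i<l)

nth≥1⇒<length : ∀ ns {i} → 1 ≤ nth ns i → i < length ns
nth≥1⇒<length (_ ∷ _)  {zero}  _   = z<s
nth≥1⇒<length (_ ∷ ns) {suc i} 1≤n = s<s (nth≥1⇒<length ns 1≤n)

part≥1⇔<len : ∀ σ {i} → 1 ≤ part σ i ⇔ i < len σ
part≥1⇔<len σ = mk⇔ (nth≥1⇒<length (parts σ)) (nth-positive (positive σ))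

part-≤-head : ∀ σ i → part σ i ≤ part σ 0
part-≤-head σ = nth-≤-head (nonincreasing σ)

prefix⇒nth-≤ : ∀ {ms ns} → Prefix _≤_ ms ns → ∀ i → nth ms i ≤ nth ns i
prefix⇒nth-≤ []        i       = z≤n
prefix⇒nth-≤ (r ∷ _)   zero    = r
prefix⇒nth-≤ (_ ∷ rs)  (suc i) = prefix⇒nth-≤ rs i

nth-≤⇒prefix : ∀ {ms} → All (_≥ 1) ms → ∀ ns → (∀ i → nth ms i ≤ nth ns i) → Prefix _≤_ ms ns
nth-≤⇒prefix []          ns       h = []
-- A positive part cannot lie below the default 0 read beyond the end.
nth-≤⇒prefix (m≥1 ∷ _)   []       h = contradiction (≤-trans m≥1 (h 0)) λ ()
nth-≤⇒prefix (_ ∷ ms≥1)  (n ∷ ns) h = h 0 ∷ nth-≤⇒prefix ms≥1 ns (h ∘ suc)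

≤ʸ⇔ : ∀ σ τ → σ ≤ʸ τ ⇔ (∀ i → part σ i ≤ part τ i)
≤ʸ⇔ σ τ = mk⇔ prefix⇒nth-≤ (nth-≤⇒prefix (positive σ) (parts τ))

∅ : Partition
∅ = mkPartition [] [] []

linked-∷ : ∀ {n ns} → nth ns 0 ≤ n → Linked _≥_ ns → Linked _≥_ (n ∷ ns)
linked-∷ {ns = []}     _ _ = [-]
linked-∷ {ns = _ ∷ _}  r l = r ∷ l

-- A leading 0 forces all later entries to be 0, so `∅` is the right result there, and `part`
-- behaves uniformly in `n`.
cons : ∀ n σ → part σ 0 ≤ n → Partition
cons zero    σ _ = ∅
cons (suc n) σ h =
  mkPartition (suc n ∷ parts σ) (s≤s z≤n ∷ positive σ) (linked-∷ h (nonincreasing σ))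

part-cons-zero : ∀ n σ h → part (cons n σ h) 0 ≡ n
part-cons-zero zero    σ h = refl
part-cons-zero (suc n) σ h = refl

part-cons-suc : ∀ n σ h i → part (cons n σ h) (suc i) ≡ part σ i
part-cons-suc zero    σ h i = sym (n≤0⇒n≡0 (≤-trans (part-≤-head σ i) h))
part-cons-suc (suc n) σ h i = refl

≤ʸ-stable : ∀ σ τ → Stable (σ ≤ʸ τ)
≤ʸ-stable σ τ = decidable-stable (prefix? _≤?_ (parts σ) (parts τ))

≡-partition-stable : (σ τ : Partition) → Stable (σ ≡ τ)
≡-partition-stable σ τ ¬¬eq = parts-injective
  (decidable-stable (≡-dec _≟_ (parts σ) (parts τ)) λ ≢ → ¬¬eq (≢ ∘ cong parts))

-- Young's order through products of primes.

∏p : List ℕ → ℕ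
∏p ns = product (map p ns)

primes-map-p : ∀ {ns} → All (_≥ 1) ns → All Prime (map p ns)
primes-map-p ns≥1 = All.map⁺ (All.map p-prime ns≥1)

p≢1⇒prime : ∀ n → p n ≢ 1 → Prime (p n)
p≢1⇒prime zero    p≢1 = contradiction refl p≢1
p≢1⇒prime (suc n) _   = next-isPrime (p n)

-- One step per index between `m` and `n`. For `m` equal to 0 the climb starts at `p 0`, which is 1,
-- and so creates a new prime factor.
raise : ∀ m n w → m ≤ n → Star Step (p m * w) (p n * w)
raise m zero w z≤n = ε
raise m (suc n) w m≤1+n with m≤n⇒m<n∨m≡n m≤1+n
... | inj₂ refl  = ε
... | inj₁ m<1+n = raise m n w (s≤s⁻¹ m<1+n) ◅◅ (step (p n) w (p≢1⇒prime n) ◅ ε)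
prefix⇒steps : ∀ {ms ns} → Prefix _≤_ ms ns → Star Step (∏p ms) (∏p ns)
prefix⇒steps {ns = []}     [] = ε
-- Rows absent from the smaller partition are grown out of the factor 1.
prefix⇒steps {ns = n ∷ ns} [] =
  prefix⇒steps {ns = ns} [] ◅◅
  subst (λ w → Star Step w (p n * ∏p ns)) (*-identityˡ (∏p ns)) (raise 0 n (∏p ns) z≤n)
prefix⇒steps {m ∷ ms} {n ∷ ns} (m≤n ∷ ms≤ns) =
  steps-* (p m) (prefix⇒steps ms≤ns) ◅◅ raise m n (∏p ns) m≤n

p≰ : ∀ {j n} → j ≰ n → p j ≰ p n
p≰ j≰n = <⇒≱ (p-mono-< (≰⇒> j≰n))

count≥-map-p : ∀ j ns → count≥ (p j) (map p ns) ≡ count≥ j ns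
count≥-map-p j []       = refl
count≥-map-p j (n ∷ ns) = go (j ≤? n)
  where
  go : Dec (j ≤ n) → count≥ (p j) (p n ∷ map p ns) ≡ count≥ j (n ∷ ns)
  go (yes j≤n) = trans (count≥-accept (map p ns) (p-mono j≤n))
    (trans (cong suc (count≥-map-p j ns)) (sym (count≥-accept ns j≤n)))
  go (no j≰n) = trans (count≥-reject (map p ns) (p≰ j≰n))
    (trans (count≥-map-p j ns) (sym (count≥-reject ns j≰n)))

linked-tail : ∀ {n ns} → Linked _≥_ (n ∷ ns) → Linked _≥_ ns
linked-tail [-]     = []
linked-tail (_ ∷ l) = l

-- Conjugation of partitions: by monotonicity the parts at least `j` come first. The condition
-- `1 ≤ j` keeps the zeros beyond the end from counting.
<count≥⇔≤nth : ∀ {ns} → Linked _≥_ ns → ∀ {j} → 1 ≤ j → ∀ i → i < count≥ j ns ⇔ j ≤ nth ns i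
<count≥⇔≤nth {[]} _ 1≤j i = mk⇔ (λ ()) (λ j≤0 → contradiction (≤-trans 1≤j j≤0) λ ())
<count≥⇔≤nth {n ∷ ns} l {j} 1≤j i = go (j ≤? n) i
  where
  IH : ∀ i → i < count≥ j ns ⇔ j ≤ nth ns i
  IH = <count≥⇔≤nth (linked-tail l) 1≤j
  go : Dec (j ≤ n) → ∀ i → i < count≥ j (n ∷ ns) ⇔ j ≤ nth (n ∷ ns) i
  go (yes j≤n) i = ⇔.trans (⇔.reflexive (cong (i <_) (count≥-accept ns j≤n))) (shift i)
    where
    shift : ∀ i → i < suc (count≥ j ns) ⇔ j ≤ nth (n ∷ ns) i
    shift zero    = mk⇔ (λ _ → j≤n) (λ _ → z<s)
    shift (suc i) = mk⇔ (to (IH i) ∘ s≤s⁻¹) (s<s ∘ from (IH i))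
  go (no j≰n) i = mk⇔
    (λ i< → contradiction
      (≤-trans (to (IH i) (subst (i <_) (count≥-reject ns j≰n) i<)) (nth-≤-head l (suc i))) j≰n)
    (λ j≤ → contradiction (≤-trans j≤ (nth-≤-head l i)) j≰n)

weight-∏p : ∀ σ j → weight (p j) (∏p (parts σ)) ≡ count≥ j (parts σ)
weight-∏p σ j = trans (weight-product (p j) (primes-map-p (positive σ))) (count≥-map-p j (parts σ))

-- Thresholds `p j` read off the columns of the diagrams; choosing `j` as the entry `part σ i` turns
-- the comparison of columns into one of rows.
weights-≤⇒≤ʸ : ∀ σ τ → (∀ t → weight t (∏p (parts σ)) ≤ weight t (∏p (parts τ))) → σ ≤ʸ τ
weights-≤⇒≤ʸ σ τ h = from (≤ʸ⇔ σ τ) λ i → go i (part σ i) refl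
  where
  go : ∀ i n → part σ i ≡ n → n ≤ part τ i
  go i zero    _  = z≤n
  go i (suc n) eq = to (<count≥⇔≤nth (nonincreasing τ) (s≤s z≤n) i)
    (<-≤-trans (from (<count≥⇔≤nth (nonincreasing σ) (s≤s z≤n) i) (≤-reflexive (sym eq)))
      (subst₂ _≤_ (weight-∏p σ (suc n)) (weight-∏p τ (suc n)) (h (p (suc n)))))

reach⇔≤ʸ : ∀ σ τ → Reach (∏p (parts σ)) (∏p (parts τ)) ⇔ σ ≤ʸ τ
reach⇔≤ʸ σ τ = mk⇔
  (λ reach → weights-≤⇒≤ʸ σ τ (reach⇒weight-≤ {∏p (parts σ)} {∏p (parts τ)} reach))
  (λ σ≤τ → steps⇒reach (prefix⇒steps σ≤τ))

-- The code compared with the product of primes.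

∏p^ : List ℕ → List ℕ → ℕ
∏p^ us ns = product (map (λ n → p n ^ multiplicity n ns) us)

∏p^-fresh : ∀ {us n} ns → All (_≢ n) us → ∏p^ us (n ∷ ns) ≡ ∏p^ us ns
∏p^-fresh ns []           = refl
∏p^-fresh {u ∷ _} ns (u≢n ∷ us≢n) = cong₂ (λ ms m → p u ^ length ms * m)
  (filter-reject (u ≟_) u≢n) (∏p^-fresh ns us≢n)

∏p^-∷ : ∀ {us n} ns → Unique us → n ∈ us → ∏p^ us (n ∷ ns) ≡ p n * ∏p^ us ns
∏p^-∷ {u ∷ us} ns (u∉us ∷ _) (here refl) = trans
  (cong₂ (λ ms m → p u ^ length ms * m)
    (filter-accept (u ≟_) refl) (∏p^-fresh ns (All.map ≢-sym u∉us)))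
  (*-assoc (p u) _ _)
∏p^-∷ {u ∷ us} {n} ns (u∉us ∷ us!) (there n∈us) = begin
  p u ^ multiplicity u (n ∷ ns) * ∏p^ us (n ∷ ns)
    ≡⟨ cong₂ (λ ms m → p u ^ length ms * m)
             (filter-reject (u ≟_) (All.lookup u∉us n∈us)) (∏p^-∷ ns us! n∈us) ⟩
  p u ^ multiplicity u ns * (p n * ∏p^ us ns)
    ≡⟨ *-assoc (p u ^ multiplicity u ns) (p n) _ ⟨
  p u ^ multiplicity u ns * p n * ∏p^ us ns
    ≡⟨ cong (_* ∏p^ us ns) (*-comm (p u ^ multiplicity u ns) (p n)) ⟩
  p n * p u ^ multiplicity u ns * ∏p^ us ns
    ≡⟨ *-assoc (p n) _ _ ⟩
  p n * (p u ^ multiplicity u ns * ∏p^ us ns) ∎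
  where open ≡-Reasoning

-- The list `us` of distinct parts stays fixed while the induction runs over `ns`; each new part
-- raises exactly one exponent.
∏p^≡∏p : ∀ {us} ns → Unique us → All (_∈ us) ns → ∏p^ us ns ≡ ∏p ns
∏p^≡∏p {us} []       us! []           = ones us
  where
  ones : ∀ us → ∏p^ us [] ≡ 1
  ones []       = refl
  ones (_ ∷ us) = trans (*-identityˡ _) (ones us)
∏p^≡∏p (n ∷ ns) us! (n∈us ∷ ns∈us) = trans (∏p^-∷ ns us! n∈us) (cong (p n *_) (∏p^≡∏p ns us! ns∈us))

∏p-ones : ∀ {ns} → All (_≡ 1) ns → ∏p ns ≡ p 1 ^ length ns
∏p-ones []            = refl
∏p-ones (refl ∷ ns≡1) = cong (p 1 *_) (∏p-ones ns≡1)

code-ones : ∀ {n ns} → All (_≡ 1) (n ∷ ns) → 2 * code (n ∷ ns) ≡ ∏p (n ∷ ns)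
code-ones {n} {ns} ns≡1 = begin
  2 * code (n ∷ ns)
    ≡⟨ cong (λ b → 2 * (if b then _ else ∏p^ (deduplicate _≟_ (n ∷ ns)) (n ∷ ns)))
            (dec-true (all? (_≟ 1) (n ∷ ns)) ns≡1) ⟩
  2 * p 1 ^ length ns     ≡⟨ cong (_* p 1 ^ length ns) p[1]≡2 ⟨
  p 1 ^ suc (length ns)   ≡⟨ ∏p-ones ns≡1 ⟨
  ∏p (n ∷ ns)             ∎
  where open ≡-Reasoning

code-¬ones : ∀ {n ns} → ¬ All (_≡ 1) (n ∷ ns) → code (n ∷ ns) ≡ ∏p (n ∷ ns)
code-¬ones {n} {ns} ¬ns≡1 = trans
  (cong (if_then p 1 ^ length ns else ∏p^ (deduplicate _≟_ (n ∷ ns)) (n ∷ ns))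
        (dec-false (all? (_≟ 1) (n ∷ ns)) ¬ns≡1))
  (∏p^≡∏p (n ∷ ns) (deduplicate-! (n ∷ ns)) (All.tabulate (∈-deduplicate⁺ _≟_)))

all≤head : ∀ {n ns} → Linked _≥_ (n ∷ ns) → All (_≤ n) (n ∷ ns)
all≤head [-]     = ≤-refl ∷ []
all≤head (r ∷ l) = ≤-refl ∷ All.map (λ m≤ → ≤-trans m≤ r) (all≤head l)

ones : ∀ σ → part σ 0 ≤ 1 → All (_≡ 1) (parts σ)
ones (mkPartition [] _ _) _ = []
ones (mkPartition (n ∷ ns) ns≥1 l) n≤1 =
  All.zipWith (λ (m≥1 , m≤n) → ≤-antisym (≤-trans m≤n n≤1) m≥1) (ns≥1 , all≤head l)

#-empty : ∀ σ → part σ 0 ≡ 0 → # σ ≡ 0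
#-empty (mkPartition [] _ _)            _    = refl
#-empty (mkPartition (_ ∷ _) (() ∷ _) _) refl

#-ones : ∀ σ → part σ 0 ≡ 1 → 2 * # σ ≡ ∏p (parts σ)
#-ones σ@(mkPartition (_ ∷ _) _ _) eq = code-ones (ones σ (≤-reflexive eq))

#-¬ones : ∀ σ → part σ 0 ≢ 0 → part σ 0 ≢ 1 → # σ ≡ ∏p (parts σ)
#-¬ones (mkPartition [] _ _)      ≢0 _  = contradiction refl ≢0
#-¬ones (mkPartition (_ ∷ _) _ _) _  ≢1 = code-¬ones λ { (eq ∷ _) → ≢1 eq }

∏p≥1 : ∀ σ → 1 ≤ ∏p (parts σ)
∏p≥1 σ = productOfPrimes≥1 (primes-map-p (positive σ))

map-p-surjective : ∀ {qs} → All Prime qs → ∃[ ns ] All (_≥ 1) ns × map p ns ≡ qs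
map-p-surjective []         = [] , [] , refl
map-p-surjective (pq ∷ pqs) with n , n≥1 , refl ← p-surjective pq
                               | ns , ns≥1 , refl ← map-p-surjective pqs =
  n ∷ ns , n≥1 ∷ ns≥1 , refl

∏p-surjective : ∀ n → 1 ≤ n → ∃[ σ ] ∏p (parts σ) ≡ n
∏p-surjective n@(suc _) _
  with record { isFactorisation = eq ; factorsPrime = pqs } ← factorise n
  with ns , ns≥1 , refl ← map-p-surjective pqs =
  mkPartition (sort ns) (All-resp-↭ (↭-sym (sort-↭ ns)) ns≥1) (sort-↗ ns) ,
  trans (product-↭ (map⁺ p (sort-↭ ns))) (sym eq)

#-surjective : ∀ n → ∃[ σ ] # σ ≡ n
#-surjective zero = ∅ , refl
#-surjective n@(suc _) with σ , eq ← ∏p-surjective n (s≤s z≤n) = go (part σ 0 ≤? 1)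
  where
  go : Dec (part σ 0 ≤ 1) → ∃[ τ ] # τ ≡ n
  -- The code halves a column, so the column of product `n` needs one further box.
  go (yes ≤1) = cons 1 σ ≤1 , *-cancelˡ-≡ _ n 2 (begin
    2 * # (cons 1 σ ≤1) ≡⟨ #-ones (cons 1 σ ≤1) refl ⟩
    p 1 * ∏p (parts σ)  ≡⟨ cong₂ _*_ p[1]≡2 eq ⟩
    2 * n               ∎)
    where open ≡-Reasoning
  go (no ≰1) = σ , trans (#-¬ones σ (λ ≡0 → ≰1 (subst (_≤ 1) (sym ≡0) z≤n)) (≰1 ∘ ≤-reflexive)) eq

-- For positive `n` this characterises the powers of 2 without exponentiation.
IsPowerOf2 : ℕ → Set
IsPowerOf2 n = ∀ q → Prime q → q ∣ n → q ≡ 2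

-- Recovers ∏p σ from # σ: the codes of the nonempty columns are the powers of 2.
Normalised : ℕ → ℕ → Set
Normalised k m =
  (k ≡ 0 → m ≡ 1) ×
  (k ≢ 0 → IsPowerOf2 k → 2 * k ≡ m) ×
  (k ≢ 0 → ¬ IsPowerOf2 k → k ≡ m)

p≡2⇒≡1 : ∀ {n} → 1 ≤ n → p n ≡ 2 → n ≡ 1
p≡2⇒≡1 n≥1 eq with m≤n⇒m<n∨m≡n n≥1
... | inj₁ 1<n = contradiction (subst₂ _<_ p[1]≡2 eq (p-mono-< 1<n)) (<-irrefl refl)
... | inj₂ 1≡n = sym 1≡n

ones⇒power : ∀ {ns} → All (_≡ 1) ns → IsPowerOf2 (∏p ns)
ones⇒power {ns} ns≡1 q pq q∣
  with m , m∈ , q∣m ← prime∣product pq (map p ns) q∣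
  with n , n∈ , refl ← ∈-map⁻ p m∈
  with refl ← All.lookup ns≡1 n∈
  with prime⇒irreducible (next-isPrime 1) q∣m
... | inj₁ refl = contradiction pq ¬prime[1]
... | inj₂ q≡p1 = trans q≡p1 p[1]≡2

normalised-∏p : ∀ σ → Normalised (# σ) (∏p (parts σ))
normalised-∏p (mkPartition [] _ _) =
  (λ _ → refl) , (λ ≢0 → contradiction refl ≢0) , (λ ≢0 → contradiction refl ≢0)
normalised-∏p σ@(mkPartition (n ∷ ns) (n≥1 ∷ _) l) = go (n ≟ 1)
  where
  ≢0 : ∀ {k} → k * # σ ≡ ∏p (parts σ) → # σ ≢ 0
  ≢0 {k} eq #≡0 = contradiction (∏p≥1 σ)
    (subst (1 ≰_) (trans (sym (trans (cong (k *_) #≡0) (*-zeroʳ k))) eq) λ ())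
  go : Dec (n ≡ 1) → Normalised (# σ) (∏p (parts σ))
  go (yes n≡1) =
    (λ #≡0 → contradiction #≡0 (≢0 {2} 2#≡)) , (λ _ _ → 2#≡) , λ _ ¬pow → contradiction pow ¬pow
    where
    2#≡ = #-ones σ n≡1
    pow : IsPowerOf2 (# σ)
    pow q pq q∣ = ones⇒power (ones σ (≤-reflexive n≡1)) q pq (subst (q ∣_) 2#≡ (∣n⇒∣m*n 2 q∣))
  go (no n≢1) =
    (λ #≡0 → contradiction #≡0 (≢0 {1} (trans (*-identityˡ _) #≡))) ,
    (λ _ pow → contradiction pow ¬pow) , (λ _ _ → #≡)
    where
    #≡ = #-¬ones σ (λ { refl → contradiction n≥1 λ () }) n≢1
    ¬pow : ¬ IsPowerOf2 (# σ)
    ¬pow pow = n≢1 (p≡2⇒≡1 n≥1 (pow (p n) (p-prime n≥1) (subst (p n ∣_) (sym #≡) (m∣m*n _))))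

-- Assuming `m ≢ n` excludes the cases in turn, which avoids deciding `IsPowerOf2 k`; decidable
-- equality then finishes.
normalised-functional : ∀ {k m n} → Normalised k m → Normalised k n → m ≡ n
normalised-functional {k} {m} {n} (a , b , c) (a′ , b′ , c′) = decidable-stable (m ≟ n) λ m≢n →
  let k≢0 = λ k≡0 → m≢n (trans (a k≡0) (sym (a′ k≡0)))
      ¬pow = λ pow → m≢n (trans (sym (b k≢0 pow)) (b′ k≢0 pow))
  in m≢n (trans (sym (c k≢0 ¬pow)) (c′ k≢0 ¬pow))

Below : ℕ → ℕ → Set
Below k l = ∀ m n → Normalised k m → Normalised l n → Reach m n

below⇔≤ʸ : ∀ σ τ → Below (# σ) (# τ) ⇔ σ ≤ʸ τ
below⇔≤ʸ σ τ = mk⇔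
  (λ h → to (reach⇔≤ʸ σ τ) (h _ _ (normalised-∏p σ) (normalised-∏p τ)))
  (λ σ≤τ m n km ln → subst₂ Reach
    (normalised-functional (normalised-∏p σ) km)
    (normalised-functional (normalised-∏p τ) ln)
    (from (reach⇔≤ʸ σ τ) σ≤τ))

normalised-def : Def² 𝐍 Normalised
normalised-def k m =
  (0-def k ⇒-def 1-def m) ×-def
  (¬-def (0-def k) ⇒-def power-def ⇒-def double-def k m) ×-def
  (¬-def (0-def k) ⇒-def ¬-def power-def ⇒-def ≡-def k m)
  where
  open Conjunction 𝐍-stable
  power-def : Def 𝐍 _ λ ρ → IsPowerOf2 (lookup ρ k)
  power-def = ∀-def (prime-def 0F ⇒-def ∣-def 0F (suc k) ⇒-def 2-def 0F)

below-def : Def² 𝐍 Below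
below-def k l = ∀-def (∀-def
  (normalised-def (2 ↑ʳ k) 1F ⇒-def normalised-def (2 ↑ʳ l) 0F ⇒-def reach-def 1F 0F))

-- If the first part `n` were not 1, then `p n` would divide 2, forcing `n` to be 1 after all. So
-- the partition is a column, and its product 4 is a power of 2 whose exponent is its length.
#≡2⇔ : ∀ {σ} → # σ ≡ 2 ⇔ σ ≡ [1]+[1]
#≡2⇔ {σ} = mk⇔
  (λ eq → parts-injective (go (parts σ) (positive σ) (nonincreasing σ) eq))
  λ { refl → #[1]+[1]≡2 }
  where
  #[1]+[1]≡2 : # [1]+[1] ≡ 2
  #[1]+[1]≡2 = *-cancelˡ-≡ (# [1]+[1]) 2 2
    (trans (#-ones [1]+[1] refl) (cong (λ q → q * (q * 1)) p[1]≡2))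
  go : ∀ ns → All (_≥ 1) ns → Linked _≥_ ns → code ns ≡ 2 → ns ≡ 1 ∷ 1 ∷ []
  go (n ∷ ns) ns≥1@(n≥1 ∷ _) l eq = by (n ≟ 1)
    where
    τ = mkPartition (n ∷ ns) ns≥1 l
    by : Dec (n ≡ 1) → n ∷ ns ≡ 1 ∷ 1 ∷ []
    by (no n≢1) = contradiction (p≡2⇒≡1 n≥1 pn≡2) n≢1
      where
      pn∣2 : p n ∣ 2
      pn∣2 = subst (p n ∣_)
        (trans (sym (#-¬ones τ (λ { refl → contradiction n≥1 λ () }) n≢1)) eq) (m∣m*n (∏p ns))
      pn≡2 : p n ≡ 2
      pn≡2 = ≤-antisym (∣⇒≤ pn∣2) (≤-trans (≤-reflexive (sym p[1]≡2)) (p-mono n≥1))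
    by (yes n≡1) = two (ones τ (≤-reflexive n≡1)) 4≡
      where
      4≡ : 2 * 2 ≡ ∏p (n ∷ ns)
      4≡ = trans (cong (2 *_) (sym eq)) (#-ones τ n≡1)
      two : ∀ {ms} → All (_≡ 1) ms → 2 * 2 ≡ ∏p ms → ms ≡ 1 ∷ 1 ∷ []
      two {ms} ms≡1 eq₄ = list ms≡1 (2^n≡4 (length ms)
        (sym (trans eq₄ (trans (∏p-ones ms≡1) (cong (_^ length ms) p[1]≡2)))))
        where
        2^n≡4 : ∀ n → 2 ^ n ≡ 4 → n ≡ 2
        2^n≡4 2 _ = refl
        2^n≡4 (suc (suc (suc n))) h = contradiction (sym h)
          (<⇒≢ (*-monoʳ-< 2 (*-monoʳ-< 2 (*-monoʳ-≤ 2 (m^n>0 2 n)))))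
        list : ∀ {ms} → All (_≡ 1) ms → length ms ≡ 2 → ms ≡ 1 ∷ 1 ∷ []
        list (refl ∷ refl ∷ []) _ = refl

-- Arithmetic in Young's lattice

-- Used both for the largest part and for the number of parts. Because `μ` is onto, comparing values
-- determines zero as the least one and the successor as the least greater one.
module Measure
  {L : Language} {A : Set} {𝔄 : Structure L A} (st : AtomsStable 𝔄)
  (μ : A → ℕ) (rep : ℕ → A) (μ-rep : ∀ n → μ (rep n) ≡ n)
  (μ-≤-def : Def² 𝔄 λ a b → μ a ≤ μ b)
  where

  open Conjunction st

  μ-≡-def : Def² 𝔄 λ a b → μ a ≡ μ b
  μ-≡-def x y = Def-resp
    (λ ρ → mk⇔ (λ (m≤n , n≤m) → ≤-antisym m≤n n≤m) λ eq → ≤-reflexive eq , ≤-reflexive (sym eq))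
    (μ-≤-def x y ×-def μ-≤-def y x)

  μ-<-def : Def² 𝔄 λ a b → μ a < μ b
  μ-<-def x y = Def-resp (λ ρ → mk⇔ ≰⇒> <⇒≱) (¬-def (μ-≤-def y x))

  μ-suc-def : Def² 𝔄 λ a b → suc (μ a) ≡ μ b
  μ-suc-def x y = Def-resp
    (λ ρ → let m = μ (lookup ρ x) in mk⇔
      (λ (m<n , least) → ≤-antisym m<n
        (subst (μ (lookup ρ y) ≤_) (μ-rep (suc m))
          (least (rep (suc m)) (≤-reflexive (sym (μ-rep (suc m)))))))
      (λ eq → ≤-reflexive eq , λ c m<c → subst (_≤ μ c) eq m<c))
    (μ-<-def x y ×-def ∀-def (μ-<-def (suc x) 0F ⇒-def μ-≤-def (suc y) 0F))

  μ-0-def : Def¹ 𝔄 λ a → μ a ≡ 0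
  μ-0-def x = Def-resp
    (λ ρ → mk⇔
      (λ h → n≤0⇒n≡0 (subst (μ (lookup ρ x) ≤_) (μ-rep 0) (h (rep 0))))
      λ eq c → subst (_≤ μ c) (sym eq) z≤n)
    (∀-def (μ-≤-def (suc x) 0F))

-- Rows, columns, rectangles and the entries of a partition.

𝐘*-stable : AtomsStable 𝐘*
𝐘*-stable .≡-stable = ≡-partition-stable
𝐘*-stable .rel-stable ≤ˢ (σ ∷ τ ∷ []) = ≤ʸ-stable σ τ

-- The first two bounds are inequalities because the rectangle is empty as soon as `a` or `n` is 0.
rectangle : ∀ a n → ∃[ τ ] part τ 0 ≤ a × len τ ≤ n × (∀ {i} → i < n → part τ i ≡ a)
rectangle a zero = ∅ , z≤n , z≤n , λ ()
rectangle a (suc n) with τ , head≤a , len≤n , parts≡a ← rectangle a n =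
  cons a τ head≤a , ≤-reflexive (part-cons-zero a τ head≤a) , len-cons a head≤a ,
  λ { {zero} _ → part-cons-zero a τ head≤a
    ; {suc i} i< → trans (part-cons-suc a τ head≤a i) (parts≡a (s≤s⁻¹ i<)) }
  where
  len-cons : ∀ a h → len (cons a τ h) ≤ suc n
  len-cons zero    _ = z≤n
  len-cons (suc _) _ = s≤s len≤n

row : ℕ → Partition
row n = proj₁ (rectangle n 1)

head-row : ∀ n → part (row n) 0 ≡ n
head-row n = proj₂ (proj₂ (proj₂ (rectangle n 1))) ≤-refl

column : ℕ → Partition
column n = proj₁ (rectangle 1 n)

len-column : ∀ n → len (column n) ≡ n
len-column n with τ , _ , len≤n , parts≡1 ← rectangle 1 n = ≤-antisym len≤n (n≤len n ≤-refl)
  where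
  n≤len : ∀ m → m ≤ n → m ≤ len τ
  n≤len zero    _   = z≤n
  n≤len (suc m) m<n = to (part≥1⇔<len τ) (≤-reflexive (sym (parts≡1 m<n)))

≤ʸ-def : Def² 𝐘* _≤ʸ_
≤ʸ-def x y = rel ≤ˢ (var x ∷ var y ∷ []) , λ _ → ⇔.refl

[1]+[1]-≤-def : Def¹ 𝐘* ([1]+[1] ≤ʸ_)
[1]+[1]-≤-def x = rel ≤ˢ (app 𝟏+𝟏 [] ∷ var x ∷ []) , λ _ → ⇔.refl

≤-[1]+[1]-def : Def¹ 𝐘* (_≤ʸ [1]+[1])
≤-[1]+[1]-def x = rel ≤ˢ (var x ∷ app 𝟏+𝟏 [] ∷ []) , λ _ → ⇔.refl

-- Hence a partition not above `[1]+[1]` has at most one row. Here the constant breaks the symmetry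
-- of Young's lattice under conjugation.
two-rows : ∀ ρ i → 1 ≤ part ρ (suc i) → [1]+[1] ≤ʸ ρ
two-rows ρ i h = from (≤ʸ⇔ [1]+[1] ρ) λ
  { zero          → ≤-trans 1≤1 (nth-antitone (nonincreasing ρ) 0)
  ; (suc zero)    → 1≤1
  ; (suc (suc _)) → z≤n }
  where
  1≤1 : 1 ≤ part ρ 1
  1≤1 = from (part≥1⇔<len ρ) (≤-trans (s≤s (s≤s z≤n)) (to (part≥1⇔<len ρ) h))

¬two-rows : ∀ n → ¬ ([1]+[1] ≤ʸ row n)
¬two-rows n h = <⇒≱ (to (part≥1⇔<len (row n)) (to (≤ʸ⇔ [1]+[1] (row n)) h 1))
  (proj₁ (proj₂ (proj₂ (rectangle n 1))))

row-≤ : ∀ σ {n} → n ≤ part σ 0 → row n ≤ʸ σ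
row-≤ σ {n} n≤ = from (≤ʸ⇔ (row n) σ) λ
  { zero    → subst (_≤ part σ 0) (sym (head-row n)) n≤
  ; (suc i) → ≮⇒≥ λ lt → ¬two-rows n (two-rows (row n) i (≤-trans (s≤s z≤n) lt)) }

≤-head⇔ : ∀ σ τ → (∀ ρ → ¬ ([1]+[1] ≤ʸ ρ) → ρ ≤ʸ σ → ρ ≤ʸ τ) ⇔ part σ 0 ≤ part τ 0
≤-head⇔ σ τ = mk⇔
  (λ h → subst (_≤ part τ 0) (head-row _)
    (to (≤ʸ⇔ (row (part σ 0)) τ) (h (row (part σ 0)) (¬two-rows (part σ 0)) (row-≤ σ ≤-refl)) 0))
  (λ σ≤τ ρ ¬two ρ≤σ → from (≤ʸ⇔ ρ τ) λ
    { zero    → ≤-trans (to (≤ʸ⇔ ρ σ) ρ≤σ 0) σ≤τ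
    ; (suc i) → ≮⇒≥ λ lt → ¬two (two-rows ρ i (≤-trans (s≤s z≤n) lt)) })

head-≤-def : Def² 𝐘* λ σ τ → part σ 0 ≤ part τ 0
head-≤-def x y = Def-resp (λ ρ → ≤-head⇔ (lookup ρ x) (lookup ρ y))
  (∀-def (¬-def ([1]+[1]-≤-def 0F) ⇒-def ≤ʸ-def 0F (suc x) ⇒-def ≤ʸ-def 0F (suc y)))

head-≤1-def : Def¹ 𝐘* λ σ → part σ 0 ≤ 1
-- The largest part of `[1]+[1]` is 1, so the constant itself serves as the bound.
head-≤1-def x = Def-resp (λ ρ → ≤-head⇔ (lookup ρ x) [1]+[1])
  (∀-def (¬-def ([1]+[1]-≤-def 0F) ⇒-def ≤ʸ-def 0F (suc x) ⇒-def ≤-[1]+[1]-def 0F))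

-- The rectangle is the largest of these `τ`, and it lies below `σ` exactly when the smallest of the
-- first `suc n` entries of `σ`, the one at `n`, is at least `a`.
box⇔ : ∀ a n σ → (∀ τ → part τ 0 ≤ a → len τ ≤ suc n → τ ≤ʸ σ) ⇔ a ≤ part σ n
box⇔ a n σ = mk⇔ fits λ a≤ τ head≤a len≤ → from (≤ʸ⇔ τ σ) λ i → bound τ head≤a len≤ a≤ i (i ≤? n)
  where
  fits : (∀ τ → part τ 0 ≤ a → len τ ≤ suc n → τ ≤ʸ σ) → a ≤ part σ n
  fits h with τ , head≤a , len≤ , parts≡a ← rectangle a (suc n) =
    subst (_≤ part σ n) (parts≡a ≤-refl) (to (≤ʸ⇔ τ σ) (h τ head≤a len≤) n)
  antitone : ∀ {i j} → i ≤ j → part σ j ≤ part σ i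
  antitone {i} i≤j with k , refl ← m≤n⇒∃[o]m+o≡n i≤j = go k
    where
    go : ∀ k → part σ (i + k) ≤ part σ i
    go zero    = ≤-reflexive (cong (part σ) (+-identityʳ i))
    go (suc k) = ≤-trans (≤-reflexive (cong (part σ) (+-suc i k)))
                         (≤-trans (nth-antitone (nonincreasing σ) (i + k)) (go k))
  bound : ∀ τ → part τ 0 ≤ a → len τ ≤ suc n → a ≤ part σ n →
          ∀ i → Dec (i ≤ n) → part τ i ≤ part σ i
  bound τ head≤a _    a≤ i (yes i≤n) =
    ≤-trans (part-≤-head τ i) (≤-trans head≤a (≤-trans a≤ (antitone i≤n)))
  bound τ _      len≤ _  i (no i≰n)  =
    ≮⇒≥ λ lt → i≰n (s≤s⁻¹ (≤-trans (to (part≥1⇔<len τ) (≤-trans (s≤s z≤n) lt)) len≤))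

-- Columns detect the number of rows as rows detect the largest part; a column is recognised by its
-- largest part being at most 1.
len-≤-def : Def² 𝐘* λ σ τ → len σ ≤ len τ
len-≤-def x y = Def-resp (λ ρ → mk⇔ (down (lookup ρ x) (lookup ρ y)) (up (lookup ρ x) (lookup ρ y)))
  (∀-def (head-≤1-def 0F ⇒-def ≤ʸ-def 0F (suc x) ⇒-def ≤ʸ-def 0F (suc y)))
  where
  up : ∀ σ τ → len σ ≤ len τ → ∀ ρ → part ρ 0 ≤ 1 → ρ ≤ʸ σ → ρ ≤ʸ τ
  up σ τ σ≤τ ρ head≤1 ρ≤σ = from (≤ʸ⇔ ρ τ) λ i → ≮⇒≥ λ lt →
    let ρᵢ≥1 = ≤-trans (s≤s z≤n) lt
        i<σ  = to (part≥1⇔<len σ) (≤-trans ρᵢ≥1 (to (≤ʸ⇔ ρ σ) ρ≤σ i))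
        τᵢ≥1 = from (part≥1⇔<len τ) (≤-trans i<σ σ≤τ)
    in <⇒≱ (≤-<-trans τᵢ≥1 lt) (≤-trans (part-≤-head ρ i) head≤1)
  down : ∀ σ τ → (∀ ρ → part ρ 0 ≤ 1 → ρ ≤ʸ σ → ρ ≤ʸ τ) → len σ ≤ len τ
  down σ τ h = go (len σ) refl
    where
    go : ∀ n → len σ ≡ n → n ≤ len τ
    go zero    _  = z≤n
    go (suc n) eq = to (part≥1⇔<len τ) (to (box⇔ 1 n τ) λ ρ head≤1 len≤ → h ρ head≤1
      (from (box⇔ 1 n σ) (from (part≥1⇔<len σ) (≤-reflexive (sym eq))) ρ head≤1 len≤))

module Head = Measure 𝐘*-stable (λ σ → part σ 0) row head-row head-≤-def
module Len  = Measure 𝐘*-stable len column len-column len-≤-def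
open Conjunction 𝐘*-stable

-- Indices are represented by lengths and values by largest parts, as the two cannot yet be
-- converted into each other. The entry is the largest width of a box that fits.
part-def : Def³ 𝐘* λ σ i τ → part σ (len i) ≡ part τ 0
part-def s i t = Def-resp (λ ρ → value⇔ (lookup ρ s) (lookup ρ i) (lookup ρ t))
  (∀-def (Len.μ-suc-def (suc i) 0F ⇒-def
    (box-def (suc t) 0F (suc s) ×-def
     ∀-def (box-def 0F 1F (2 ↑ʳ s) ⇒-def head-≤-def 0F (2 ↑ʳ t)))))
  where
  Box : Partition → Partition → Partition → Set
  Box a b σ = ∀ τ → part τ 0 ≤ part a 0 → len τ ≤ len b → τ ≤ʸ σ
  box-def : Def³ 𝐘* Box
  box-def a b s = ∀-def (head-≤-def 0F (suc a) ⇒-def len-≤-def 0F (suc b) ⇒-def ≤ʸ-def 0F (suc s))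
  box : ∀ a b i σ → suc (len i) ≡ len b → Box a b σ ⇔ part a 0 ≤ part σ (len i)
  box a b i σ eq rewrite sym eq = box⇔ (part a 0) (len i) σ
  value⇔ : ∀ σ i τ →
    (∀ b → suc (len i) ≡ len b → Box τ b σ × (∀ a → Box a b σ → part a 0 ≤ part τ 0)) ⇔
           part σ (len i) ≡ part τ 0
  value⇔ σ i τ = mk⇔
    (λ h → ≤-antisym
      (subst (_≤ part τ 0) (head-row _)
        (proj₂ (h b eq) (row m) (from (box (row m) b i σ eq) (≤-reflexive (head-row m)))))
      (to (box τ b i σ eq) (proj₁ (h b eq))))
    (λ eq b suc≡ → from (box τ b i σ suc≡) (≤-reflexive (sym eq)) ,
       λ a fits → subst (part a 0 ≤_) eq (to (box a b i σ suc≡) fits))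
    where
    m = part σ (len i)
    b = column (suc (len i))
    eq = sym (len-column (suc (len i)))

-- Definability of recursion.

recurse : (ℕ → ℕ → ℕ) → ℕ → ℕ → ℕ
recurse f zero    b = b
recurse f (suc n) b = recurse f n (f n b)

recurse-suc : ∀ f n b → recurse f (suc n) b ≡ f 0 (recurse (f ∘ suc) n b)
recurse-suc f zero    b = refl
recurse-suc f (suc n) b = recurse-suc f n (f (suc n) b)

-- The start `b` is entry `n` and the result is entry 0, so the history runs from the back of the
-- partition to its front. This is why `recurse` uses the highest index first.
Trace : (ℕ → ℕ → ℕ) → ℕ → ℕ → Partition → Set
Trace f n b τ = part τ n ≡ b × (∀ {i} → i < n → part τ i ≡ f i (part τ (suc i)))

trace-head : ∀ {f} n {b} τ → Trace f n b τ → part τ 0 ≡ recurse f n b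
trace-head zero    τ (eq , _) = eq
trace-head {f} (suc n) τ (eq , steps) = trace-head n τ
  (trans (steps ≤-refl) (cong (f n) eq) , λ i<n → steps (m≤n⇒m≤1+n i<n))

-- The history is built from its tail: `τ₀` holds the entries behind the current value, and `incr`
-- keeps the extended sequence nonincreasing.
trace-exists : ∀ {f} → (∀ i v → v ≤ f i v) → ∀ n b τ₀ → part τ₀ 0 ≤ b →
               ∃[ τ ] Trace f n b τ × (∀ i → part τ (suc n + i) ≡ part τ₀ i)
trace-exists incr zero b τ₀ h =
  cons b τ₀ h , (part-cons-zero b τ₀ h , λ ()) , part-cons-suc b τ₀ h
trace-exists {f} incr (suc n) b τ₀ h
  with τ , (eq , steps) , tail ← trace-exists incr n (f n b) (cons b τ₀ h)
         (≤-trans (≤-reflexive (part-cons-zero b τ₀ h)) (incr n b)) =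
  τ , (last , steps′) , λ i → trans (cong (part τ) (sym (+-suc (suc n) i)))
    (trans (tail (suc i)) (part-cons-suc b τ₀ h i))
  where
  last : part τ (suc n) ≡ b
  last = trans (cong (part τ) (sym (+-identityʳ (suc n)))) (trans (tail 0) (part-cons-zero b τ₀ h))
  steps′ : ∀ {i} → i < suc n → part τ i ≡ f i (part τ (suc i))
  steps′ {i} i<1+n with m≤n⇒m<n∨m≡n (s≤s⁻¹ i<1+n)
  ... | inj₁ i<n  = steps i<n
  ... | inj₂ refl = trans eq (cong (f n) (sym last))

-- The partitions themselves serve as computation histories: as f is increasing
-- in its second argument, the values of the recursion form a nonincreasing sequence.
recurse-def : ∀ {n} {f : Vec Partition n → ℕ → ℕ → ℕ} → (∀ ρ i v → v ≤ f ρ i v) →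
  {P : Pred (Vec Partition (4 + n)) 0ℓ} →
  (∀ w v i τ ρ → P (w ∷ v ∷ i ∷ τ ∷ ρ) ⇔ f ρ (len i) (part v 0) ≡ part w 0) →
  Def 𝐘* (4 + n) P →
  (l b y : Fin n) →
  Def 𝐘* n λ ρ → recurse (f ρ) (len (lookup ρ l)) (part (lookup ρ b) 0) ≡ part (lookup ρ y) 0
recurse-def {n} {f} incr {P} P⇔f P-def l b y = Def-resp (λ ρ → value⇔ ρ)
  -- A trace exists and all traces have the same first entry, so a universal quantifier expresses
  -- the value.
  (∀-def (trace-def ⇒-def Head.μ-≡-def 0F (suc y)))
  where
  trace⇔ : ∀ τ ρ →
    (part τ (len (lookup ρ l)) ≡ part (lookup ρ b) 0 ×
     (∀ i v w → len i < len (lookup ρ l) → (∀ j → suc (len i) ≡ len j → part τ (len j) ≡ part v 0) →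
      P (w ∷ v ∷ i ∷ τ ∷ ρ) → part τ (len i) ≡ part w 0)) ⇔
    Trace (f ρ) (len (lookup ρ l)) (part (lookup ρ b) 0) τ
  trace⇔ τ ρ = mk⇔
    (λ (last , steps) → last , λ {i} →
      -- Every index is the length of a column and every value the largest part of a row, so
      -- quantifying over partitions reaches all numbers.
      subst (λ i → i < _ → part τ i ≡ f ρ i (part τ (suc i))) (len-column i)
      λ i<l → let i′ = column i
                  v = row (part τ (suc (len i′)))
                  w = row (f ρ (len i′) (part τ (suc (len i′))))
              in trans
        (steps i′ v w i<l
          (λ j suc≡ → trans (cong (part τ) (sym suc≡)) (sym (head-row _)))
          (from (P⇔f w v i′ τ ρ) (trans (cong (f ρ (len i′)) (head-row _)) (sym (head-row _)))))
        (head-row _))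
    λ (last , steps) → last , λ i v w i<l v≡ Pw → trans (steps i<l)
      (trans (cong (f ρ (len i))
               (trans (cong (part τ) (sym (len-column _)))
                 (v≡ (column (suc (len i))) (sym (len-column _)))))
             (to (P⇔f w v i τ ρ) Pw))
  trace-def : Def 𝐘* (suc n) λ ρ′ →
    Trace (f (tail ρ′)) (len (lookup (tail ρ′) l)) (part (lookup (tail ρ′) b) 0) (head ρ′)
  trace-def = Def-resp (λ { (τ ∷ ρ) → trace⇔ τ ρ })
    (part-def 0F (suc l) (suc b) ×-def
     ∀-def (∀-def (∀-def
       (Len.μ-<-def 2F (4 ↑ʳ l) ⇒-def
        ∀-def (Len.μ-suc-def 3F 0F ⇒-def part-def 4F 0F 2F) ⇒-def
        P-def ⇒-def part-def 3F 2F 0F))))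
  value⇔ : ∀ ρ →
    (∀ τ → Trace (f ρ) (len (lookup ρ l)) (part (lookup ρ b) 0) τ →
      part τ 0 ≡ part (lookup ρ y) 0) ⇔
    recurse (f ρ) (len (lookup ρ l)) (part (lookup ρ b) 0) ≡ part (lookup ρ y) 0
  value⇔ ρ = mk⇔
    (λ h → let τ , trace , _ = trace-exists (incr ρ) (len (lookup ρ l)) (part (lookup ρ b) 0) ∅ z≤n
           in trans (sym (trace-head _ τ trace)) (h τ trace))
    (λ eq τ trace → trans (trace-head _ τ trace) eq)

-- Sums, products, primes and codes in Young's lattice.

recurse-+ : ∀ m n b → recurse (λ _ v → m + v) n b ≡ n * m + b
recurse-+ m zero    b = refl
recurse-+ m (suc n) b = trans (recurse-suc (λ _ v → m + v) n b)
  (trans (cong (m +_) (recurse-+ m n b)) (sym (+-assoc m (n * m) b)))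

recurse-next : ∀ n → recurse (λ _ → next) n 1 ≡ p n
recurse-next zero    = refl
recurse-next (suc n) = trans (recurse-suc (λ _ → next) n 1) (cong next (recurse-next n))

recurse-∏p : ∀ ns → recurse (λ i v → p (nth ns i) * v) (length ns) 1 ≡ ∏p ns
recurse-∏p []       = refl
recurse-∏p (n ∷ ns) = trans (recurse-suc (λ i v → p (nth (n ∷ ns) i) * v) (length ns) 1)
  (cong (p n *_) (recurse-∏p ns))

len+head-def : Def³ 𝐘* λ σ τ ρ → len σ + part τ 0 ≡ part ρ 0
len+head-def x y z = Def-resp
  (λ ρ → ⇔.reflexive (cong (_≡ _) (trans
    (recurse-+ 1 (len (lookup ρ x)) (part (lookup ρ y) 0))
    (cong (_+ _) (*-identityʳ (len (lookup ρ x)))))))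
  (recurse-def {f = λ _ _ → suc} (λ _ _ → n≤1+n) (λ _ _ _ _ _ → ⇔.refl)
    (Head.μ-suc-def 1F 0F) x y z)

-- Adding a length to the value 0 yields the same number as a largest part, which links the two
-- representations.
len≡head-def : Def² 𝐘* λ σ τ → len σ ≡ part τ 0
len≡head-def x y = Def-resp
  (λ ρ → mk⇔ (λ h → trans (sym (+-identityʳ _)) (h ∅ refl))
             (λ eq o o≡0 → trans (cong (_ +_) o≡0) (trans (+-identityʳ _) eq)))
  (∀-def (Head.μ-0-def 0F ⇒-def len+head-def (suc x) 0F (suc y)))

head-+-def : Def³ 𝐘* λ σ τ ρ → part σ 0 + part τ 0 ≡ part ρ 0
head-+-def x y z = Def-resp
  (λ ρ → mk⇔ (λ h → let n = part (lookup ρ x) 0 in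
               trans (cong (_+ part (lookup ρ y) 0) (sym (len-column n)))
                 (h (column n) (len-column n)))
             (λ eq l l≡ → trans (cong (_+ part (lookup ρ y) 0) l≡) eq))
  (∀-def (len≡head-def 0F (suc x) ⇒-def len+head-def 0F (suc y) (suc z)))

head-*-def : Def³ 𝐘* λ σ τ ρ → part σ 0 * part τ 0 ≡ part ρ 0
head-*-def x y z = Def-resp
  (λ ρ → let n = part (lookup ρ x) 0 ; m = part (lookup ρ y) 0 in mk⇔
    (λ h → trans (sym (trans (recurse-+ m (len (column n)) 0)
                   (trans (+-identityʳ _) (cong (_* m) (len-column n)))))
                 (h (column n) (len-column n) ∅ refl))
    (λ eq l l≡ o o≡0 → trans (recurse-+ m (len l) (part o 0))
      (trans (cong₂ _+_ (cong (_* m) l≡) o≡0) (trans (+-identityʳ _) eq))))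
  (∀-def (len≡head-def 0F (suc x) ⇒-def ∀-def (Head.μ-0-def 0F ⇒-def
    recurse-def {f = λ ρ _ v → part (lookup ρ (2 ↑ʳ y)) 0 + v}
      (λ ρ _ v → m≤n+m v _) (λ _ _ _ _ _ → ⇔.refl)
      (head-+-def (6 ↑ʳ y) 1F 0F)
      1F 0F (2 ↑ʳ z))))

module Rows = Interpretation (λ σ → part σ 0) row head-row Head.μ-≡-def head-+-def head-*-def

head-1-def : Def¹ 𝐘* λ σ → part σ 0 ≡ 1
head-1-def = Rows.lift¹ (_≡ 1) 1-def

p-def : Def² 𝐘* λ σ τ → p (part σ 0) ≡ part τ 0
p-def x y = Def-resp
  (λ ρ → let n = part (lookup ρ x) 0 in mk⇔
    (λ h → trans (sym (recurse-next n)) (trans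
      (sym (cong₂ (recurse λ _ → next) (len-column n) (head-row 1)))
      (h (column n) (len-column n) (row 1) (head-row 1))))
    (λ eq l l≡ o o≡1 → trans (cong₂ (recurse λ _ → next) l≡ o≡1) (trans (recurse-next n) eq)))
  (∀-def (len≡head-def 0F (suc x) ⇒-def ∀-def (head-1-def 0F ⇒-def
    recurse-def {f = λ _ _ → next} (λ _ _ v → <⇒≤ (n<next[n] v)) (λ _ _ _ _ _ → ⇔.refl)
      (Rows.lift² (λ m n → next m ≡ n) next-def 1F 0F) 1F 0F (2 ↑ʳ y))))

-- A recursion of length `len σ` whose step at `i` multiplies by the prime of entry `i`; the steps
-- are increasing since `p` is at least 1.
∏p-def : Def² 𝐘* λ σ τ → ∏p (parts σ) ≡ part τ 0
∏p-def x y = Def-resp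
  (λ ρ → let σ = lookup ρ x in mk⇔
    (λ h → trans (sym (recurse-∏p (parts σ))) (trans
      (sym (cong (recurse (λ i v → p (part σ i) * v) (len σ)) (head-row 1)))
      (h (row 1) (head-row 1))))
    (λ eq o o≡1 → trans (cong (recurse (λ i v → p (part σ i) * v) (len σ)) o≡1)
      (trans (recurse-∏p (parts σ)) eq)))
  (∀-def (head-1-def 0F ⇒-def
    recurse-def {f = λ ρ i v → p (part (lookup ρ (suc x)) i) * v}
      (λ ρ i v → m≤n*m v (p (part (lookup ρ (suc x)) i))
        {{>-nonZero (p≥1 (part (lookup ρ (suc x)) i))}})
      (λ w v i τ ρ → factor⇔ (lookup ρ (suc x)) i v w)
      (∀-def (part-def (6 ↑ʳ x) 3F 0F ⇒-def
        ∀-def (p-def 1F 0F ⇒-def head-*-def 0F 3F 2F)))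
      (suc x) 0F (suc y)))
  where
  factor⇔ : ∀ σ i v w →
    (∀ k → part σ (len i) ≡ part k 0 → ∀ q → p (part k 0) ≡ part q 0 →
      part q 0 * part v 0 ≡ part w 0) ⇔
    p (part σ (len i)) * part v 0 ≡ part w 0
  factor⇔ σ i v w = mk⇔
    (λ h → let n = part σ (len i) in trans
      (cong (_* part v 0) (trans (cong p (sym (head-row n))) (sym (head-row (p (part (row n) 0))))))
      (h (row n) (sym (head-row n)) (row (p (part (row n) 0))) (sym (head-row _))))
    (λ eq k n≡ q p≡ → trans (cong (_* part v 0) (trans (sym p≡) (cong p (sym n≡)))) eq)

-- The largest part separates the clauses of the code: 0 for `∅`, 1 for nonempty columns, at least 2
-- otherwise.
#-def : Def² 𝐘* λ σ τ → # σ ≡ part τ 0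
#-def x y = Def-resp (λ ρ → #⇔ (lookup ρ x) (lookup ρ y))
  ((Head.μ-0-def x ⇒-def Head.μ-0-def y) ×-def
   (head-1-def x ⇒-def ∀-def (∏p-def (suc x) 0F ⇒-def
     Rows.lift² (λ m n → 2 * m ≡ n) double-def (suc y) 0F)) ×-def
   (¬-def (Head.μ-0-def x) ⇒-def ¬-def (head-1-def x) ⇒-def ∏p-def x y))
  where
  #⇔ : ∀ σ τ →
    ((part σ 0 ≡ 0 → part τ 0 ≡ 0) ×
     (part σ 0 ≡ 1 → ∀ m → ∏p (parts σ) ≡ part m 0 → 2 * part τ 0 ≡ part m 0) ×
     (part σ 0 ≢ 0 → part σ 0 ≢ 1 → ∏p (parts σ) ≡ part τ 0)) ⇔
    # σ ≡ part τ 0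
  #⇔ σ τ = mk⇔ (λ (empty , ones , rest) → code≡ empty ones rest (part σ 0 ≟ 0) (part σ 0 ≟ 1))
    λ #≡ → (λ ≡0 → trans (sym #≡) (#-empty σ ≡0)) ,
           (λ ≡1 m ∏≡ → trans (cong (2 *_) (sym #≡)) (trans (#-ones σ ≡1) ∏≡)) ,
           (λ ≢0 ≢1 → trans (sym (#-¬ones σ ≢0 ≢1)) #≡)
    where
    code≡ : _ → _ → _ → Dec (part σ 0 ≡ 0) → Dec (part σ 0 ≡ 1) → # σ ≡ part τ 0
    code≡ empty ones rest (yes ≡0) _ = trans (#-empty σ ≡0) (sym (empty ≡0))
    code≡ empty ones rest (no _) (yes ≡1) = *-cancelˡ-≡ (# σ) (part τ 0) 2
      (trans (#-ones σ ≡1) (trans (sym (head-row _))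
        (sym (ones ≡1 (row (∏p (parts σ))) (sym (head-row _))))))
    code≡ empty ones rest (no ≢0) (no ≢1) = trans (#-¬ones σ ≢0 ≢1) (rest ≢0 ≢1)

-- Codes are first named as largest parts, where arithmetic is already definable.
#-rel-def : (R : ℕ → ℕ → ℕ → Set) → (Def³ 𝐘* λ σ τ ρ → R (part σ 0) (part τ 0) (part ρ 0)) →
            Def³ 𝐘* λ σ τ ρ → R (# σ) (# τ) (# ρ)
#-rel-def R R-def x y z = Def-resp
  (λ ρ → let k = # (lookup ρ x) ; m = # (lookup ρ y) ; n = # (lookup ρ z) in mk⇔
    (λ h → subst id (cong₃ (head-row k) (head-row m) (head-row n))
      (h (row k) (row m) (row n) (sym (head-row k)) (sym (head-row m)) (sym (head-row n))))
    (λ r a b c x≡ y≡ z≡ → subst id (cong₃ x≡ y≡ z≡) r))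
  (∀-def (∀-def (∀-def
    (#-def (3 ↑ʳ x) 2F ⇒-def #-def (3 ↑ʳ y) 1F ⇒-def #-def (3 ↑ʳ z) 0F ⇒-def
     R-def 2F 1F 0F))))
  where
  cong₃ : ∀ {a a′ b b′ c c′} → a ≡ a′ → b ≡ b′ → c ≡ c′ → R a b c ≡ R a′ b′ c′
  cong₃ refl refl refl = refl

-- Translating the atomic formulas in both directions.

𝐍#-≈-def : ∀ {n} (s t : Term arith n) → Def 𝐘* n (Sat 𝐍# (s ≈ t))
𝐍#-≈-def (var x) (var y) = ≡-def x y

𝐍#-rel-def : ∀ {n k} (R : ArithRel k) (ts : Vec (Term arith n) k) → Def 𝐘* n (Sat 𝐍# (rel R ts))
𝐍#-rel-def +ˢ (var x ∷ var y ∷ var z ∷ []) = #-rel-def (λ k m n → k + m ≡ n) head-+-def x y z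
𝐍#-rel-def ×ˢ (var x ∷ var y ∷ var z ∷ []) = #-rel-def (λ k m n → k * m ≡ n) head-*-def x y z

#-+-def : Def³ 𝐍# λ σ τ ρ → # σ + # τ ≡ # ρ
#-+-def x y z = rel +ˢ (var x ∷ var y ∷ var z ∷ []) , λ _ → ⇔.refl

#-*-def : Def³ 𝐍# λ σ τ ρ → # σ * # τ ≡ # ρ
#-*-def x y z = rel ×ˢ (var x ∷ var y ∷ var z ∷ []) , λ _ → ⇔.refl

#-≡-def : Def² 𝐍# λ σ τ → # σ ≡ # τ
#-≡-def x y = Def-resp
  (λ ρ → mk⇔
    (λ h → trans (sym (+-identityʳ _)) (h ∅ refl))
    (λ eq o o+o≡o → trans
      (cong (_ +_) (+-cancelˡ-≡ (# o) (# o) 0 (trans o+o≡o (sym (+-identityʳ (# o))))))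
      (trans (+-identityʳ _) eq)))
  -- The hypothesis `# o + # o ≡ # o` singles out the code 0, and adding 0 compares two codes.
  (∀-def (#-+-def 0F 0F 0F ⇒-def #-+-def (suc x) 0F (suc y)))

module Codes = Interpretation # (λ n → proj₁ (#-surjective n)) (λ n → proj₂ (#-surjective n))
                              #-≡-def #-+-def #-*-def

≤ʸ-def-𝐍# : Def² 𝐍# _≤ʸ_
≤ʸ-def-𝐍# x y = Def-resp (λ ρ → below⇔≤ʸ (lookup ρ x) (lookup ρ y))
  (Codes.lift² Below below-def x y)

[1]+[1]-def-𝐍# : Def¹ 𝐍# (_≡ [1]+[1])
[1]+[1]-def-𝐍# x = Def-resp (λ _ → #≡2⇔) (Codes.lift¹ (_≡ 2) 2-def x)

𝐘*-≈-def : ∀ {n} (s t : Term young* n) → Def 𝐍# n (Sat 𝐘* (s ≈ t))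
𝐘*-≈-def (var x)      (var y)      = ≡-def x y
𝐘*-≈-def (var x)      (app 𝟏+𝟏 []) = [1]+[1]-def-𝐍# x
𝐘*-≈-def (app 𝟏+𝟏 []) (var y)      = Def-resp (λ _ → mk⇔ sym sym) ([1]+[1]-def-𝐍# y)
𝐘*-≈-def (app 𝟏+𝟏 []) (app 𝟏+𝟏 []) = Def-resp (λ _ → mk⇔ (λ _ → refl) (λ _ → id)) (¬-def ⊥-def)

𝐘*-rel-def : ∀ {n k} (R : YoungRel k) (ts : Vec (Term young* n) k) → Def 𝐍# n (Sat 𝐘* (rel R ts))
𝐘*-rel-def ≤ˢ (var x ∷ var y ∷ []) = ≤ʸ-def-𝐍# x y
𝐘*-rel-def ≤ˢ (var x ∷ app 𝟏+𝟏 [] ∷ []) = Def-resp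
  (λ _ → mk⇔ (λ h → h _ refl) λ { h _ refl → h })
  (∀-def ([1]+[1]-def-𝐍# 0F ⇒-def ≤ʸ-def-𝐍# (suc x) 0F))
𝐘*-rel-def ≤ˢ (app 𝟏+𝟏 [] ∷ var y ∷ []) = Def-resp
  (λ _ → mk⇔ (λ h → h _ refl) λ { h _ refl → h })
  (∀-def ([1]+[1]-def-𝐍# 0F ⇒-def ≤ʸ-def-𝐍# 0F (suc y)))
𝐘*-rel-def ≤ˢ (app 𝟏+𝟏 [] ∷ app 𝟏+𝟏 [] ∷ []) = Def-resp
  (λ _ → mk⇔ (λ h → h _ refl) λ { h _ refl → h })
  (∀-def ([1]+[1]-def-𝐍# 0F ⇒-def ≤ʸ-def-𝐍# 0F 0F))

theorem4p4 : (n : ℕ) → Def 𝐘* n ≐ Def 𝐍# n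
theorem4p4 n =
  (λ (φ , R⇔φ) → Def-resp (λ ρ → ⇔.sym (R⇔φ ρ)) (Sat-def 𝐘*-≈-def 𝐘*-rel-def φ)) ,
  (λ (φ , R⇔φ) → Def-resp (λ ρ → ⇔.sym (R⇔φ ρ)) (Sat-def 𝐍#-≈-def 𝐍#-rel-def φ))
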